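{- For $i=1,2$, let $\mathcal G_i=\bigl(\ast_{k\in I_i}\mathbb Z\bigr)\ast\bigl(\ast_{j\in J_i}\mathbb Z/2\mathbb Z\bigr)=\langle x_k,y_j\ (k\in I_i,\ j\in J_i)\mid y_j^2\rangle$ with generating system $X_i=\{x_k\}_{k\in I_i}\sqcup\{y_j\}_{j\in J_i}$, let $\mathcal H_i\le\mathcal G_i$ be a subgroup, and let $\Gamma_i=\mathrm{Sch}(\mathcal G_i,\mathcal H_i,X_i)$. Then there exists a graph isomorphism (not required to preserve labels) $\Gamma_1\to\Gamma_2$ mapping the vertex $\mathcal H_1$ to the vertex $\mathcal H_2$ if and only if $\mathcal G_1$ and $\mathcal G_2$ have the same degree and $\mathcal H_1$ and $\mathcal H_2$ are length-isomorphic. Moreover, there exists a label-preserving isomorphism $\Gamma_1\to\Gamma_2$ mapping the vertex $\mathcal H_1$ to the vertex $\mathcal H_2$ if and only if $\mathcal G_1=\mathcal G_2$ and $\mathcal H_1=\mathcal H_2$.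
   Context: Graphs: a graph has a vertex set $V$, an edge set $E$, a map $\iota:E\to V$ (initial vertex) and an involution $e\mapsto\bar e$ on $E$ (inverse edge); the final vertex of $e$ is $\iota(\bar e)$; loops and multiple edges are allowed, and an edge with $\bar e=e$ (a degenerate loop) is allowed. A graph isomorphism is a bijection on vertices and on edges commuting with $\iota$ and with the inverse map; a label-preserving isomorphism additionally preserves edge labels. For a group $\mathcal A$ with generating system $X$ (a multiset of elements of $\mathcal A$ generating it), $X^{\pm}$ denotes $X\cup X^{ -1}$, and the Schreier graph $\mathrm{Sch}(\mathcal A,\mathcal H,X)$ of a subgroup $\mathcal H$ has as vertices the right cosets $\mathcal Hg$, and for each coset $\mathcal Hg$ and each $x$ with $x\in X$ or $x^{ -1}\in X$ an edge labeled $x$ from $\mathcal Hg$ to $\mathcal Hgx$, the inverse of this edge being the edge labeled $x^{ -1}$ from $\mathcal Hgx$ (the edge is its own inverse when $x=x^{ -1}$ and $\mathcal Hgx=\mathcal Hg$). The degree of $\mathcal A$ with respect to $X$ is the degree of any vertex of the Cayley graph, i.e. the number of $x\in X$ of order at most $2$ plus twice the number of $x\in X$ of order at least $3$. The length $|g|_X$ of $g$ is the minimal $n$ such that $g$ is a product of $n$ elements of $X^{\pm}$. Subgroups $\mathcal H_1\le\mathcal G_1$, $\mathcal H_2\le\mathcal G_2$ are length-isomorphic if there is a group isomorphism $\alpha:\mathcal H_1\to\mathcal H_2$ with $|\alpha(h)|_{X_2}=|h|_{X_1}$ for all $h\in\mathcal H_1$.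
   Formalization: The implication from "same degree and length-isomorphic" to "graph isomorphism" is proved only for finite degree; it fails for infinite degree (free group on x₁,x₂,…, with H₁ the whole group and H₂=⟨x₂,x₃,…⟩). -}

module Defs where

open import Algebra.Bundles using (Group)
open import Algebra.Morphism.Structures using (module GroupMorphisms)
open import Algebra.Structures using (IsGroup)
import Algebra.Properties.Group as GroupProperties
open import Data.Fin.Base using (Fin)
open import Data.Integer.Base using (ℤ; 0ℤ; 1ℤ; -1ℤ; _+_)
import Data.Integer.Properties as ℤ
open import Data.List.Base using (List; []; _∷_; [_]; _++_; map; foldr; reverse; length)
open import Data.List.Properties using (++-assoc; ++-identityʳ; unfold-reverse)
open import Data.Nat.Base using (ℕ; _≤_)
open import Data.Product.Base using (Σ; Σ-syntax; ∃; ∃-syntax; _×_; _,_; proj₁; proj₂; map₁)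
open import Data.Product.Relation.Binary.Pointwise.NonDependent using (_×ₛ_)
open import Data.Refinement using (Refinement-syntax; value; refine)
open import Data.Sign.Base using (Sign; opposite) renaming (+ to pos; - to neg)
open import Data.Sum.Base as Sum using (_⊎_; inj₁; inj₂)
open import Function.Bundles using (Func; Inverse; _⇔_)
open import Level using (0ℓ; suc)
open import Relation.Binary.Bundles using (Setoid)
import Relation.Binary.Construct.On as On
import Relation.Binary.Reasoning.Setoid as SetoidReasoning
open import Relation.Binary.PropositionalEquality
  using (_≡_; refl; sym; trans; cong; setoid)
open import Relation.Nullary.Negation using (contradiction)
open import Relation.Unary using (Pred; _∈_; _⊆_; _≐_)

------------------------------------------------------------------------
-- Graphs

-- Vertices and edges form setoids because the vertices of a Schreier
-- graph are cosets.  A degenerate loop is an edge e with inv e ≈ e.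

record Graph : Set (suc 0ℓ) where
  field
    vertices       : Setoid 0ℓ 0ℓ
    edges          : Setoid 0ℓ 0ℓ
    initial        : Func edges vertices
    inverse        : Func edges edges

  module V = Setoid vertices
  module E = Setoid edges

  ι : E.Carrier → V.Carrier
  ι = Func.to initial

  inv : E.Carrier → E.Carrier
  inv = Func.to inverse

  field
    inv-involutive : ∀ e → inv (inv e) E.≈ e

-- The edges with a given initial vertex; the degree of v is the
-- cardinality of this setoid.
star : (Γ : Graph) → Graph.V.Carrier Γ → Setoid 0ℓ 0ℓ
star Γ v = On.setoid {B = ∃[ e ] ι e V.≈ v} edges proj₁
  where open Graph Γ

record GraphIsomorphism (Γ₁ Γ₂ : Graph) : Set where
  private
    module Γ₁ = Graph Γ₁
    module Γ₂ = Graph Γ₂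
  field
    onVertices : Inverse Γ₁.vertices Γ₂.vertices
    onEdges    : Inverse Γ₁.edges Γ₂.edges

  mapᵛ : Γ₁.V.Carrier → Γ₂.V.Carrier
  mapᵛ = Inverse.to onVertices

  mapᵉ : Γ₁.E.Carrier → Γ₂.E.Carrier
  mapᵉ = Inverse.to onEdges

  field
    ι-commute   : ∀ e → Γ₂.ι (mapᵉ e) Γ₂.V.≈ mapᵛ (Γ₁.ι e)
    inv-commute : ∀ e → Γ₂.inv (mapᵉ e) Γ₂.E.≈ mapᵉ (Γ₁.inv e)

Labelling : Graph → Set → Set
Labelling Γ L = Func (Graph.edges Γ) (setoid L)

LabelPreserving : ∀ {Γ₁ Γ₂ L} → Labelling Γ₁ L → Labelling Γ₂ L →
                  GraphIsomorphism Γ₁ Γ₂ → Set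
LabelPreserving ℓ₁ ℓ₂ f = ∀ e → Func.to ℓ₂ (mapᵉ e) ≡ Func.to ℓ₁ e
  where open GraphIsomorphism f

------------------------------------------------------------------------
-- Subgroups

record Subgroup (G : Group 0ℓ 0ℓ) : Set (suc 0ℓ) where
  open Group G hiding (refl; sym; trans; setoid)
  field
    Member    : Pred Carrier 0ℓ
    resp      : ∀ {g h} → g ≈ h → g ∈ Member → h ∈ Member
    ε-closed  : ε ∈ Member
    ∙-closed  : ∀ {g h} → g ∈ Member → h ∈ Member → g ∙ h ∈ Member
    ⁻¹-closed : ∀ {g} → g ∈ Member → g ⁻¹ ∈ Member

  group : Group 0ℓ 0ℓ
  group = record
    { Carrier = ∃ Member
    ; _≈_     = λ g h → proj₁ g ≈ proj₁ h
    ; _∙_     = λ (g , g∈H) (h , h∈H) → g ∙ h , ∙-closed g∈H h∈H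
    ; ε       = ε , ε-closed
    ; _⁻¹     = λ (g , g∈H) → g ⁻¹ , ⁻¹-closed g∈H
    ; isGroup = record
      { isMonoid = record
        { isSemigroup = record
          { isMagma = record
            { isEquivalence = On.isEquivalence proj₁ isEquivalence
            ; ∙-cong        = ∙-cong
            }
          ; assoc = λ (f , _) (g , _) (h , _) → assoc f g h
          }
        ; identity = (λ (g , _) → identityˡ g) , (λ (g , _) → identityʳ g)
        }
      ; inverse = (λ (g , _) → inverseˡ g) , (λ (g , _) → inverseʳ g)
      ; ⁻¹-cong = ⁻¹-cong
      }
    }

  -- Right cosets: g ~ h when Hg = Hh.
  cosets : Setoid 0ℓ 0ℓ
  cosets = record
    { Carrier = Carrier
    ; _≈_     = λ g h → g ∙ h ⁻¹ ∈ Member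
    ; isEquivalence = record
      { refl  = λ {g} → resp (Eq.sym (inverseʳ g)) ε-closed
      ; sym   = λ {g} {h} p → resp (flip-quotient g h) (⁻¹-closed p)
      ; trans = λ {f} {g} {h} p q → resp (compose f g h) (∙-closed p q)
      }
    }
    where
    module Eq = Group G
    open GroupProperties G
    open SetoidReasoning (Group.setoid G)

    flip-quotient : ∀ g h → (g ∙ h ⁻¹) ⁻¹ ≈ h ∙ g ⁻¹
    flip-quotient g h = begin
      (g ∙ h ⁻¹) ⁻¹    ≈⟨ ⁻¹-anti-homo-∙ g (h ⁻¹) ⟩
      h ⁻¹ ⁻¹ ∙ g ⁻¹   ≈⟨ ∙-congʳ (⁻¹-involutive h) ⟩
      h ∙ g ⁻¹         ∎

    compose : ∀ f g h → (f ∙ g ⁻¹) ∙ (g ∙ h ⁻¹) ≈ f ∙ h ⁻¹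
    compose f g h = begin
      (f ∙ g ⁻¹) ∙ (g ∙ h ⁻¹)   ≈⟨ assoc f (g ⁻¹) (g ∙ h ⁻¹) ⟩
      f ∙ (g ⁻¹ ∙ (g ∙ h ⁻¹))   ≈⟨ ∙-congˡ (\\-leftDividesʳ g (h ⁻¹)) ⟩
      f ∙ h ⁻¹                  ∎

trivialSubgroup : (G : Group 0ℓ 0ℓ) → Subgroup G
trivialSubgroup G = record
  { Member    = _≈ ε
  ; resp      = λ g≈h g≈ε → Eq.trans (Eq.sym g≈h) g≈ε
  ; ε-closed  = Eq.refl
  ; ∙-closed  = λ p q → Eq.trans (∙-cong p q) (identityˡ ε)
  ; ⁻¹-closed = λ p → Eq.trans (⁻¹-cong p) ε⁻¹≈ε
  }
  where
  open Group G hiding (refl; sym; trans; setoid)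
  module Eq = Group G
  open GroupProperties G using (ε⁻¹≈ε)

------------------------------------------------------------------------
-- Generating systems

Signed : Set → Set
Signed S = S × Sign

flip : ∀ {S} → Signed S → Signed S
flip (x , s) = x , opposite s

flip-involutive : ∀ {S} (a : Signed S) → flip (flip a) ≡ a
flip-involutive (x , neg) = refl
flip-involutive (x , pos) = refl

module Evaluation (G : Group 0ℓ 0ℓ) {S : Set} (element : S → Group.Carrier G) where
  open Group G hiding (refl; sym; trans; setoid)

  ⟦_⟧ : Signed S → Carrier
  ⟦ x , pos ⟧ = element x
  ⟦ x , neg ⟧ = element x ⁻¹

  ∏ : List (Signed S) → Carrier
  ∏ = foldr (λ a g → ⟦ a ⟧ ∙ g) ε

-- A multiset of elements is an indexed family.
record GeneratingSystem (G : Group 0ℓ 0ℓ) : Set (suc 0ℓ) where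
  open Group G hiding (refl; sym; trans; setoid)
  field
    Index     : Set
    element   : Index → Carrier
  open Evaluation G element public
  field
    generates : ∀ g → ∃[ w ] ∏ w ≈ g

  -- X^±.  Identifying only equal elements with the same index, x and
  -- x⁻¹ give one letter if x has order at most 2 and two otherwise,
  -- while repeated elements of the multiset stay distinct.
  letters : Setoid 0ℓ 0ℓ
  letters = record
    { Carrier = Signed Index
    ; _≈_     = λ a b → proj₁ a ≡ proj₁ b × ⟦ a ⟧ ≈ ⟦ b ⟧
    ; isEquivalence = record
      { refl  = refl , Eq.refl
      ; sym   = λ (p , q) → sym p , Eq.sym q
      ; trans = λ (p , q) (p′ , q′) → trans p p′ , Eq.trans q q′
      }
    }
    where module Eq = Group G

  -- |g|_X = n.
  HasLength : Carrier → ℕ → Set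
  HasLength g n = (∃[ w ] length w ≡ n × ∏ w ≈ g)
                × (∀ w → ∏ w ≈ g → n ≤ length w)

LengthIsomorphic : ∀ {G₁ G₂} → GeneratingSystem G₁ → GeneratingSystem G₂ →
                   Subgroup G₁ → Subgroup G₂ → Set
LengthIsomorphic X₁ X₂ H₁ H₂ =
  Σ[ α ∈ (H₁.Carrier → H₂.Carrier) ]
    IsGroupIsomorphism α ×
    (∀ h n → X₁.HasLength (proj₁ h) n ⇔ X₂.HasLength (proj₁ (α h)) n)
  where
  module X₁ = GeneratingSystem X₁
  module X₂ = GeneratingSystem X₂
  module H₁ = Group (Subgroup.group H₁)
  module H₂ = Group (Subgroup.group H₂)
  open GroupMorphisms H₁.rawGroup H₂.rawGroup

------------------------------------------------------------------------
-- Schreier graphs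

-- The edge (g , a) is the one labelled a leaving the coset Hg.
Sch : (G : Group 0ℓ 0ℓ) → Subgroup G → GeneratingSystem G → Graph
Sch G H X = record
  { vertices       = cosets
  ; edges          = cosets ×ₛ letters
  ; initial        = record { to = proj₁ ; cong = proj₁ }
  ; inverse        = record
    { to   = λ (g , a) → g ∙ ⟦ a ⟧ , flip a
    ; cong = λ { {g , a} {h , b} (g~h , x≡y , a≈b) →
        resp (Eq.sym (step g h ⟦ a ⟧ ⟦ b ⟧ a≈b)) g~h ,
        x≡y ,
        Eq.trans (⟦flip⟧ a) (Eq.trans (⁻¹-cong a≈b) (Eq.sym (⟦flip⟧ b))) }
    }
  ; inv-involutive = λ { (g , a) →
      ≈⇒~ (Eq.trans (∙-congˡ (⟦flip⟧ a)) (//-rightDividesʳ ⟦ a ⟧ g)) ,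
      refl ,
      Eq.reflexive (cong ⟦_⟧ (flip-involutive a)) }
  }
  where
  open Group G hiding (refl; sym; trans; setoid)
  module Eq = Group G
  open Subgroup H using (cosets; resp; ε-closed)
  open GeneratingSystem X
  open GroupProperties G
  open SetoidReasoning (Group.setoid G)

  ⟦flip⟧ : ∀ a → ⟦ flip a ⟧ ≈ ⟦ a ⟧ ⁻¹
  ⟦flip⟧ (x , pos) = Eq.refl
  ⟦flip⟧ (x , neg) = Eq.sym (⁻¹-involutive (element x))

  ≈⇒~ : ∀ {g h} → g ≈ h → Setoid._≈_ cosets g h
  ≈⇒~ {g} {h} g≈h =
    resp (Eq.sym (Eq.trans (∙-congʳ g≈h) (inverseʳ h))) ε-closed

  step : ∀ g h a b → a ≈ b → (g ∙ a) ∙ (h ∙ b) ⁻¹ ≈ g ∙ h ⁻¹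
  step g h a b a≈b = begin
    (g ∙ a) ∙ (h ∙ b) ⁻¹      ≈⟨ ∙-cong (∙-congˡ a≈b) (⁻¹-anti-homo-∙ h b) ⟩
    (g ∙ b) ∙ (b ⁻¹ ∙ h ⁻¹)   ≈⟨ assoc g b (b ⁻¹ ∙ h ⁻¹) ⟩
    g ∙ (b ∙ (b ⁻¹ ∙ h ⁻¹))   ≈⟨ ∙-congˡ (\\-leftDividesˡ b (h ⁻¹)) ⟩
    g ∙ h ⁻¹                  ∎

Cayley : (G : Group 0ℓ 0ℓ) → GeneratingSystem G → Graph
Cayley G = Sch G (trivialSubgroup G)

starAtIdentity : ∀ {G} → GeneratingSystem G → Setoid 0ℓ 0ℓ
starAtIdentity {G} X = star (Cayley G X) (Group.ε G)

-- Equality of degrees as (possibly infinite) cardinals.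
SameDegree : ∀ {G₁ G₂} → GeneratingSystem G₁ → GeneratingSystem G₂ → Set
SameDegree X₁ X₂ = Inverse (starAtIdentity X₁) (starAtIdentity X₂)

-- Finiteness cannot be dropped when reconstructing a Schreier graph from
-- lengths: in the free group on x₁, x₂, …, the whole group and ⟨x₂, x₃, …⟩
-- are length-isomorphic, but only the first has a one-vertex Schreier graph.
FiniteDegree : ∀ {G} → GeneratingSystem G → Set
FiniteDegree X = ∃[ n ] Inverse (starAtIdentity X) (setoid (Fin n))

------------------------------------------------------------------------
-- Groups given by generators and relators

module Presentation {S : Set} (Relator : Pred (List (Signed S)) 0ℓ) where

  infix 4 _≈_
  data _≈_ : List (Signed S) → List (Signed S) → Set where
    ≈-refl   : ∀ {u} → u ≈ u
    ≈-sym    : ∀ {u v} → u ≈ v → v ≈ u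
    ≈-trans  : ∀ {u v w} → u ≈ v → v ≈ w → u ≈ w
    ++-cong  : ∀ {u u′ v v′} → u ≈ u′ → v ≈ v′ → u ++ v ≈ u′ ++ v′
    cancel   : ∀ a → a ∷ flip a ∷ [] ≈ []
    relator  : ∀ {r} → r ∈ Relator → r ≈ []

  ≈-setoid : Setoid 0ℓ 0ℓ
  ≈-setoid = record
    { _≈_ = _≈_
    ; isEquivalence = record { refl = ≈-refl ; sym = ≈-sym ; trans = ≈-trans }
    }

  ≡⇒≈ : ∀ {u v} → u ≡ v → u ≈ v
  ≡⇒≈ refl = ≈-refl

  _⁻¹ : List (Signed S) → List (Signed S)
  w ⁻¹ = reverse (map flip w)

  private
    open SetoidReasoning ≈-setoid

    inverseʳ : ∀ w → w ++ w ⁻¹ ≈ []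
    inverseʳ []      = ≈-refl
    inverseʳ (a ∷ w) = begin
      a ∷ w ++ (a ∷ w) ⁻¹
        ≡⟨ cong (λ u → a ∷ w ++ u) (unfold-reverse (flip a) (map flip w)) ⟩
      a ∷ w ++ (w ⁻¹ ++ [ flip a ])
        ≡⟨ cong (a ∷_) (++-assoc w (w ⁻¹) [ flip a ]) ⟨
      [ a ] ++ (w ++ w ⁻¹) ++ [ flip a ]
        ≈⟨ ++-cong (≈-refl {[ a ]}) (++-cong (inverseʳ w) ≈-refl) ⟩
      a ∷ flip a ∷ []
        ≈⟨ cancel a ⟩
      [] ∎

    cancel′ : ∀ a → flip a ∷ a ∷ [] ≈ []
    cancel′ a = begin
      flip a ∷ a ∷ []               ≡⟨ cong (λ b → flip a ∷ b ∷ []) (flip-involutive a) ⟨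
      flip a ∷ flip (flip a) ∷ []   ≈⟨ cancel (flip a) ⟩
      []                            ∎

    inverseˡ : ∀ w → w ⁻¹ ++ w ≈ []
    inverseˡ []      = ≈-refl
    inverseˡ (a ∷ w) = begin
      (a ∷ w) ⁻¹ ++ a ∷ w
        ≡⟨ cong (_++ a ∷ w) (unfold-reverse (flip a) (map flip w)) ⟩
      (w ⁻¹ ++ [ flip a ]) ++ a ∷ w
        ≡⟨ ++-assoc (w ⁻¹) [ flip a ] (a ∷ w) ⟩
      w ⁻¹ ++ (flip a ∷ a ∷ []) ++ w
        ≈⟨ ++-cong (≈-refl {w ⁻¹}) (++-cong (cancel′ a) ≈-refl) ⟩
      w ⁻¹ ++ w
        ≈⟨ inverseˡ w ⟩
      [] ∎

    ⁻¹-cong : ∀ {u v} → u ≈ v → u ⁻¹ ≈ v ⁻¹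
    ⁻¹-cong {u} {v} u≈v = begin
      u ⁻¹                  ≡⟨ ++-identityʳ (u ⁻¹) ⟨
      u ⁻¹ ++ []            ≈⟨ ++-cong (≈-refl {u ⁻¹}) (inverseʳ v) ⟨
      u ⁻¹ ++ (v ++ v ⁻¹)   ≈⟨ ++-cong (≈-refl {u ⁻¹}) (++-cong u≈v ≈-refl) ⟨
      u ⁻¹ ++ (u ++ v ⁻¹)   ≡⟨ ++-assoc (u ⁻¹) u (v ⁻¹) ⟨
      (u ⁻¹ ++ u) ++ v ⁻¹   ≈⟨ ++-cong (inverseˡ u) ≈-refl ⟩
      v ⁻¹                  ∎

  group : Group 0ℓ 0ℓ
  group = record
    { Carrier = List (Signed S)
    ; _≈_     = _≈_
    ; _∙_     = _++_
    ; ε       = []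
    ; _⁻¹     = _⁻¹
    ; isGroup = record
      { isMonoid = record
        { isSemigroup = record
          { isMagma = record
            { isEquivalence = Setoid.isEquivalence ≈-setoid
            ; ∙-cong        = ++-cong
            }
          ; assoc = λ u v w → ≡⇒≈ (++-assoc u v w)
          }
        ; identity = (λ _ → ≈-refl) , (λ w → ≡⇒≈ (++-identityʳ w))
        }
      ; inverse = inverseˡ , inverseʳ
      ; ⁻¹-cong = ⁻¹-cong
      }
    }

  generators : GeneratingSystem group
  generators = record
    { Index     = S
    ; element   = element
    ; generates = λ w → w , ≡⇒≈ (∏≡id w)
    }
    where
    element : S → List (Signed S)
    element x = [ x , pos ]

    open Evaluation group element

    ∏≡id : ∀ w → ∏ w ≡ w
    ∏≡id []              = refl
    ∏≡id ((x , pos) ∷ w) = cong ((x , pos) ∷_) (∏≡id w)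
    ∏≡id ((x , neg) ∷ w) = cong ((x , neg) ∷_) (∏≡id w)

------------------------------------------------------------------------
-- Free products of copies of ℤ and ℤ/2ℤ

-- The index sets are subsets I ⊆ 𝕂 and J ⊆ 𝕁 of ambient sets, so that
-- generators (hence labels) of different groups can be compared: x_k and
-- y_j depend only on k : 𝕂 and j : 𝕁.  Membership proofs are irrelevant.

module _ {𝕂 𝕁 : Set} where

  Generator : Pred 𝕂 0ℓ → Pred 𝕁 0ℓ → Set
  Generator I J = [ k ∈ 𝕂 ∣ I k ] ⊎ [ j ∈ 𝕁 ∣ J j ]

  pattern x k = inj₁ k
  pattern y j = inj₂ j

  data SquareRelator {I J} : Pred (List (Signed (Generator I J))) 0ℓ where
    y² : ∀ j → ((y j , pos) ∷ (y j , pos) ∷ []) ∈ SquareRelator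

  module _ (I : Pred 𝕂 0ℓ) (J : Pred 𝕁 0ℓ) where

    𝒢 : Group 0ℓ 0ℓ
    𝒢 = Presentation.group (SquareRelator {I} {J})

    𝒳 : GeneratingSystem 𝒢
    𝒳 = Presentation.generators (SquareRelator {I} {J})

    Γ : Subgroup 𝒢 → Graph
    Γ H = Sch 𝒢 H 𝒳

  -- The coset H itself.
  root : ∀ {I J} (H : Subgroup (𝒢 I J)) → Graph.V.Carrier (Γ I J H)
  root _ = []

  -- A label is x_k or x_k⁻¹, or y_j, which is its own inverse.
  Label : Set
  Label = 𝕂 × Sign ⊎ 𝕁

  label : ∀ {I J} → Signed (Generator I J) → Label
  label (x k , s) = inj₁ (value k , s)
  label (y j , _) = inj₂ (value j)

  module _ {I : Pred 𝕂 0ℓ} {J : Pred 𝕁 0ℓ} where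

    private
      open Presentation (SquareRelator {I} {J})

      weight : Signed (Generator I J) → ℤ
      weight (x _ , pos) = 1ℤ
      weight (x _ , neg) = -1ℤ
      weight (y _ , _)   = 0ℤ

      exponent : List (Signed (Generator I J)) → ℤ
      exponent = foldr (λ a n → weight a + n) 0ℤ

      exponent-++ : ∀ u v → exponent (u ++ v) ≡ exponent u + exponent v
      exponent-++ []      v = sym (ℤ.+-identityˡ (exponent v))
      exponent-++ (a ∷ u) v =
        trans (cong (weight a +_) (exponent-++ u v))
              (sym (ℤ.+-assoc (weight a) (exponent u) (exponent v)))

      exponent-cong : ∀ {u v} → u ≈ v → exponent u ≡ exponent v
      exponent-cong ≈-refl          = refl
      exponent-cong (≈-sym p)       = sym (exponent-cong p)
      exponent-cong (≈-trans p q)   = trans (exponent-cong p) (exponent-cong q)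
      exponent-cong (++-cong {u} {u′} {v} {v′} p q)
        rewrite exponent-++ u v | exponent-++ u′ v′
              | exponent-cong p | exponent-cong q = refl
      exponent-cong (cancel (x _ , pos)) = refl
      exponent-cong (cancel (x _ , neg)) = refl
      exponent-cong (cancel (y _ , _))   = refl
      exponent-cong (relator (y² _))     = refl

    labelling : (H : Subgroup (𝒢 I J)) → Labelling (Γ I J H) Label
    labelling H = record
      { to   = λ (_ , a) → label a
      ; cong = λ { {_ , a} {_ , b} (_ , a≈b) → label-cong a b a≈b }
      }
      where
      open GeneratingSystem (𝒳 I J) using (letters)

      label-cong : ∀ a b → Setoid._≈_ letters a b → label a ≡ label b
      label-cong (x _ , pos) (x _ , pos) (refl , _)   = refl
      label-cong (x _ , neg) (x _ , neg) (refl , _)   = refl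
      label-cong (x _ , pos) (x _ , neg) (refl , a≈b) =
        contradiction (exponent-cong a≈b) λ ()
      label-cong (x _ , neg) (x _ , pos) (refl , a≈b) =
        contradiction (exponent-cong a≈b) λ ()
      label-cong (y _ , _)   (y _ , _)   (refl , _)   = refl

  rename : ∀ {I₁ I₂ J₁ J₂} → I₁ ⊆ I₂ → J₁ ⊆ J₂ →
           List (Signed (Generator I₁ J₁)) → List (Signed (Generator I₂ J₂))
  rename I⊆ J⊆ = map (map₁ (Sum.map (refine I⊆) (refine J⊆)))

  -- 𝒢₁ = 𝒢₂ and H₁ = H₂.  Equality of groups with their generating systems
  -- is equality of the index sets; H₁ and H₂ are then subsets of one group,
  -- and renaming only changes the (irrelevant) membership proofs.
  EqualSubgroups : ∀ {I₁ I₂ J₁ J₂} → Subgroup (𝒢 I₁ J₁) → Subgroup (𝒢 I₂ J₂) → Set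
  EqualSubgroups {I₁} {I₂} {J₁} {J₂} H₁ H₂ =
    Σ[ I≐ ∈ I₁ ≐ I₂ ] Σ[ J≐ ∈ J₁ ≐ J₂ ]
      (∀ w → w ∈ Subgroup.Member H₁ ⇔
             rename (proj₁ I≐) (proj₁ J≐) w ∈ Subgroup.Member H₂)

  module _ {I₁ I₂ J₁ J₂} (H₁ : Subgroup (𝒢 I₁ J₁)) (H₂ : Subgroup (𝒢 I₂ J₂)) where

    private
      Γ₁ = Γ I₁ J₁ H₁
      Γ₂ = Γ I₂ J₂ H₂

    MapsRoot : GraphIsomorphism Γ₁ Γ₂ → Set
    MapsRoot f = mapᵛ (root H₁) V.≈ root H₂
      where
      open GraphIsomorphism f
      open Graph Γ₂

    RootedIsomorphic : Set
    RootedIsomorphic = Σ[ f ∈ GraphIsomorphism Γ₁ Γ₂ ] MapsRoot f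

    RootedLabelIsomorphic : Set
    RootedLabelIsomorphic =
      Σ[ f ∈ GraphIsomorphism Γ₁ Γ₂ ]
        LabelPreserving (labelling H₁) (labelling H₂) f × MapsRoot f

{-# OPTIONS --safe #-}
module Submission where

open import Defs
open import Algebra.Bundles using (Group)
open import Algebra.Morphism.Structures using (module GroupMorphisms)
import Algebra.Properties.Group as GroupProperties
open import Axiom.ExcludedMiddle using (ExcludedMiddle)
open import Data.Fin.Base using (Fin)
open import Data.Fin.Permutation as Permutation
  using (Permutation′; transpose; _∘ₚ_; _⟨$⟩ʳ_)
open import Data.Fin.Properties using (_≟_)
open import Data.Irrelevant using () renaming ([_] to irr)
open import Data.List.Base using (List; []; _∷_; [_]; _++_; map; length; foldr; head; allFin)
open import Data.List.Membership.Propositional using () renaming (_∈_ to _∈ₗ_)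
open import Data.List.Membership.Propositional.Properties using (∈-allFin)
open import Data.List.Properties
  using (++-assoc; ++-identityʳ; foldr-++; length-map; length-reverse; unfold-reverse)
open import Data.List.Relation.Unary.Any using (here; there)
open import Data.List.Relation.Unary.Linked as Linked using (Linked; []; [-]; _∷_)
open import Data.Maybe.Base using (just)
open import Data.Maybe.Properties using (just-injective; ≡-dec)
open import Data.Nat.Base as ℕ using (ℕ; _+_; _≤_; z≤n; s≤s)
open import Data.Nat.Properties using
  ( ≤-refl; ≤-reflexive; ≤-trans; ≤-antisym; m≤n⇒m≤1+n; n≤1+n; +-mono-≤; +-suc
  ; <-irrefl; suc-injective )
open import Data.Product.Base using (Σ-syntax; ∃-syntax; _×_; _,_; proj₁; proj₂; map₁)
open import Data.Refinement using (_,_; refine)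
open import Data.Sign.Base using () renaming (+ to pos; - to neg)
open import Data.Sum.Base as Sum using (inj₁; inj₂)
open import Function.Base using (_∘_)
open import Function.Bundles using (Func; Injection; Inverse; _⇔_; mk⇔; Equivalence)
import Function.Construct.Composition as Composition
import Function.Construct.Symmetry as Symmetry
open import Function.Properties.Inverse using (↔⇒↣)
open import Level using (0ℓ)
open import Relation.Binary.Bundles using (Setoid)
open import Relation.Binary.PropositionalEquality
  using (_≡_; _≢_; refl; sym; trans; cong; cong₂; subst; setoid; module ≡-Reasoning)
import Relation.Binary.Reasoning.Setoid as SetoidReasoning
open import Relation.Nullary.Decidable using (yes; no; recompute; dec-true; dec-false)
open import Relation.Nullary.Negation using (contradiction)
open import Relation.Unary using (Pred; _∈_; _⊆_)

-- A rooted isomorphism relabels the edges leaving each coset; reading words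
-- from the root through this relabelling maps H₁ isomorphically onto H₂ and
-- preserves lengths.  Conversely, such a relabelling has to be found from a
-- length-preserving α : H₁ ≅ H₂.  In the Cayley trees, match g with g′ when
-- d(g , h) = d(g′ , α h) for all h ∈ H₁.  Whether the geodesics from g to h
-- and to k start with the same edge is decided by the lengths of g⁻¹h, g⁻¹k
-- and h⁻¹k, so "first edge towards h ↦ first edge towards α h" is a partial
-- injection between the edges at g and at g′.  By finiteness it extends to a
-- bijection, and the neighbours of g and g′ along corresponding edges match
-- again.  Starting from the identities, this yields a map of trees; it is
-- H₁-equivariant because each bijection depends only on its partial injection.

-- Right cosets and degrees.

module RightCosets {G : Group 0ℓ 0ℓ} (H : Subgroup G) where
  open Group G hiding (refl; sym; trans; setoid)
  private module Eq = Group G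
  open GroupProperties G
  open Subgroup H using (Member; resp; ε-closed; ∙-closed; ⁻¹-closed; cosets)
  open Setoid cosets public using () renaming
    (_≈_ to infix 4 _∼_; refl to ∼-refl; sym to ∼-sym; trans to ∼-trans)

  ≈⇒∼ : ∀ {g h} → g ≈ h → g ∼ h
  ≈⇒∼ {g} {h} g≈h = resp (Eq.sym (Eq.trans (∙-congʳ g≈h) (inverseʳ h))) ε-closed

  ∙-congʳ-∼ : ∀ g h k → g ∼ h → g ∙ k ∼ h ∙ k
  ∙-congʳ-∼ g h k = resp (Eq.sym (begin
    (g ∙ k) ∙ (h ∙ k) ⁻¹      ≈⟨ ∙-congˡ (⁻¹-anti-homo-∙ h k) ⟩
    (g ∙ k) ∙ (k ⁻¹ ∙ h ⁻¹)   ≈⟨ assoc g k (k ⁻¹ ∙ h ⁻¹) ⟩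
    g ∙ (k ∙ (k ⁻¹ ∙ h ⁻¹))   ≈⟨ ∙-congˡ (\\-leftDividesˡ k (h ⁻¹)) ⟩
    g ∙ h ⁻¹                  ∎))
    where open SetoidReasoning (Group.setoid G)

  ∈⇒∙∼ : ∀ {h} g → h ∈ Member → h ∙ g ∼ g
  ∈⇒∙∼ {h} g = resp (Eq.sym (//-rightDividesʳ g h))

  ∈⇒∼ε : ∀ {h} → h ∈ Member → h ∼ ε
  ∈⇒∼ε = resp (Eq.sym (Eq.trans (∙-congˡ ε⁻¹≈ε) (identityʳ _)))

  ∼ε⇒∈ : ∀ {h} → h ∼ ε → h ∈ Member
  ∼ε⇒∈ = resp (Eq.trans (∙-congˡ ε⁻¹≈ε) (identityʳ _))

-- Invariance of the word metric, in which `h` and `k` are at distance the length of `h ⁻¹ ∙ k`,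
-- under left translation.
quotient-cancel : ∀ (G : Group 0ℓ 0ℓ) → let open Group G in
                  ∀ u h k → (u ∙ h) ⁻¹ ∙ (u ∙ k) ≈ h ⁻¹ ∙ k
quotient-cancel G u h k = begin
  (u ∙ h) ⁻¹ ∙ (u ∙ k)      ≈⟨ ∙-congʳ (⁻¹-anti-homo-∙ u h) ⟩
  (h ⁻¹ ∙ u ⁻¹) ∙ (u ∙ k)   ≈⟨ assoc (h ⁻¹) (u ⁻¹) (u ∙ k) ⟩
  h ⁻¹ ∙ (u ⁻¹ ∙ (u ∙ k))   ≈⟨ ∙-congˡ (\\-leftDividesʳ u k) ⟩
  h ⁻¹ ∙ k                  ∎
  where
  open Group G
  open GroupProperties G
  open SetoidReasoning (Group.setoid G)

-- In the Cayley graph the vertex of an edge in this star is determined up to equality, so only its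
-- letter varies and degrees become cardinalities of `letters`.
star≅letters : ∀ {G} (X : GeneratingSystem G) →
               Inverse (starAtIdentity X) (GeneratingSystem.letters X)
star≅letters {G} X = record
  { to        = λ ((_ , a) , _) → a
  ; from      = λ a → (ε , a) , ∼-refl {ε}
  ; to-cong   = proj₂
  ; from-cong = ∼-refl {ε} ,_
  ; inverse   = proj₂ , λ { {(g , a) , g∼ε} b≋a → ∼-sym {g} {ε} g∼ε , b≋a }
  }
  where
  open Group G using (ε)
  open RightCosets (trivialSubgroup G)

-- Letters and words of the free product.

module Words {𝕂 𝕁 : Set} (I : Pred 𝕂 0ℓ) (J : Pred 𝕁 0ℓ) where
  open Presentation (SquareRelator {I = I} {J}) public
    using (_≈_; ≈-refl; ≈-sym; ≈-trans; ++-cong; cancel; relator; ≡⇒≈; _⁻¹; ≈-setoid)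
  open GeneratingSystem (𝒳 I J) public using (letters; HasLength; ⟦_⟧; ∏)
  open Setoid letters public using () renaming
    (_≈_ to infix 4 _≋_; refl to ≋-refl; sym to ≋-sym; trans to ≋-trans)

  Letter Word : Set
  Letter = Signed (Generator I J)
  Word   = List Letter

  ⟦⟧≡[] : ∀ a → ⟦ a ⟧ ≡ [ a ]
  ⟦⟧≡[] (_ , pos) = refl
  ⟦⟧≡[] (_ , neg) = refl

  ∏≡id : ∀ w → ∏ w ≡ w
  ∏≡id []      = refl
  ∏≡id (a ∷ w) = cong₂ _++_ (⟦⟧≡[] a) (∏≡id w)

  ≋⇒≈ : ∀ a b → a ≋ b → [ a ] ≈ [ b ]
  ≋⇒≈ a b (_ , p) =
    ≈-trans (≡⇒≈ (sym (⟦⟧≡[] a))) (≈-trans p (≡⇒≈ (⟦⟧≡[] b)))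

  ∷-cong : ∀ a b {u v} → a ≋ b → u ≈ v → a ∷ u ≈ b ∷ v
  ∷-cong a b a≋b = ++-cong (≋⇒≈ a b a≋b)

  ≡⇒≋ : ∀ {a b} → a ≡ b → a ≋ b
  ≡⇒≋ {a} refl = ≋-refl {a}

  flip-cong : ∀ a b → a ≋ b → flip a ≋ flip b
  flip-cong (_ , pos) (_ , pos) (refl , _) = refl , ≈-refl
  flip-cong (_ , pos) (_ , neg) (refl , p) = refl , ≈-sym p
  flip-cong (_ , neg) (_ , pos) (refl , p) = refl , ≈-sym p
  flip-cong (_ , neg) (_ , neg) (refl , _) = refl , ≈-refl

  cancel-∷ : ∀ a w → a ∷ flip a ∷ w ≈ w
  cancel-∷ a w = ++-cong (cancel a) (≈-refl {w})

  -- Inserting `y⁻¹ y` in front of `y` gives `y⁻¹ y y`, whose last two letters are the relator.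
  y-involution : ∀ j → (y j , pos) ≋ (y j , neg)
  y-involution j = refl , ≈-trans
    (≈-sym (cancel-∷ (y j , neg) [ y j , pos ]))
    (++-cong (≈-refl {[ y j , neg ]}) (relator (y² j)))

  label-cong : ∀ a b → a ≋ b → label a ≡ label b
  label-cong a b a≋b =
    Func.cong (labelling (trivialSubgroup (𝒢 I J))) {[] , a} {[] , b} (≈-refl , a≋b)

  -- Indices with equal values are definitionally equal, their proofs being irrelevant. Only the
  -- sign of a `y j`, which its label forgets, calls for the relator.
  label-injective : ∀ a b → label a ≡ label b → a ≋ b
  label-injective (x _ , s) (x _ , .s)      refl = refl , ≈-refl
  label-injective (y j , pos) (y _ , pos) refl = refl , ≈-refl
  label-injective (y j , pos) (y _ , neg) refl = y-involution j
  label-injective (y j , neg) (y _ , pos) refl = refl , ≈-sym (proj₂ (y-involution j))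
  label-injective (y j , neg) (y _ , neg) refl = refl , ≈-refl

-- Translating words by transducers.

module _ {𝕂 𝕁 : Set} (I₁ I₂ : Pred 𝕂 0ℓ) (J₁ J₂ : Pred 𝕁 0ℓ) where
  private
    module W₁ = Words I₁ J₁
    module W₂ = Words I₂ J₂

  -- The states will be cosets, the outputs the labels of the image edges.
  record Transducer : Set₁ where
    field
      states : Setoid 0ℓ 0ℓ
    open Setoid states renaming (Carrier to Q; _≈_ to _≈Q_) hiding (refl; sym; trans)
    private module Q = Setoid states
    field
      next      : Q → W₁.Letter → Q
      out       : Q → W₁.Letter → W₂.Letter
      next-cong : ∀ {p q} a b → p ≈Q q → a W₁.≋ b → next p a ≈Q next q b
      out-cong  : ∀ {p q} a b → p ≈Q q → a W₁.≋ b → out p a W₂.≋ out q b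
      next-flip : ∀ q a → next (next q a) (flip a) ≈Q q
      out-flip  : ∀ q a → out (next q a) (flip a) W₂.≋ flip (out q a)

    final : Q → W₁.Word → Q
    final q []      = q
    final q (a ∷ w) = final (next q a) w

    run : Q → W₁.Word → W₂.Word
    run q []      = []
    run q (a ∷ w) = out q a ∷ run (next q a) w

    length-run : ∀ q w → length (run q w) ≡ length w
    length-run q []      = refl
    length-run q (a ∷ w) = cong ℕ.suc (length-run (next q a) w)

    final-++ : ∀ q u v → final q (u ++ v) ≡ final (final q u) v
    final-++ q []      v = refl
    final-++ q (a ∷ u) v = final-++ (next q a) u v

    run-++ : ∀ q u v → run q (u ++ v) ≡ run q u ++ run (final q u) v
    run-++ q []      v = refl
    run-++ q (a ∷ u) v = cong (out q a ∷_) (run-++ (next q a) u v)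

    run-congˡ : ∀ {p q} w → p ≈Q q → run p w W₂.≈ run q w × final p w ≈Q final q w
    run-congˡ []      p≈q = W₂.≈-refl , p≈q
    run-congˡ {p} {q} (a ∷ w) p≈q =
      let (r , f) = run-congˡ w (next-cong a a p≈q (W₁.≋-refl {a}))
      in W₂.∷-cong (out p a) (out q a) (out-cong a a p≈q (W₁.≋-refl {a})) r , f

    -- Asking only for `b ≋ flip a` makes both a cancelling pair and the relator `y j y j`
    -- instances.
    run-backtrack : ∀ q a b → b W₁.≋ flip a →
                    run q (a ∷ b ∷ []) W₂.≈ [] × final q (a ∷ b ∷ []) ≈Q q
    run-backtrack q a b b≋ā =
      W₂.≈-trans
        (W₂.∷-cong (out q a) (out q a) (W₂.≋-refl {out q a})
          (W₂.≋⇒≈ (out (next q a) b) (flip (out q a))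
            (W₂.≋-trans {out (next q a) b} {out (next q a) (flip a)} {flip (out q a)}
              (out-cong b (flip a) Q.refl b≋ā) (out-flip q a))))
        (W₂.cancel (out q a)) ,
      Q.trans (next-cong b (flip a) Q.refl b≋ā) (next-flip q a)

    -- Induction on the derivation of `u ≈ v`. Outputs and final states are compared together
    -- because the second factor of a product is read from the state in which the first one ends.
    run-cong : ∀ {p q u v} → p ≈Q q → u W₁.≈ v →
               run p u W₂.≈ run q v × final p u ≈Q final q v
    run-cong {u = u} p≈q W₁.≈-refl = run-congˡ u p≈q
    run-cong p≈q (W₁.≈-sym e) =
      let (r , f) = run-cong (Q.sym p≈q) e in W₂.≈-sym r , Q.sym f
    run-cong p≈q (W₁.≈-trans e e′) =
      let (r , f) = run-cong p≈q e ; (r′ , f′) = run-cong Q.refl e′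
      in W₂.≈-trans r r′ , Q.trans f f′
    run-cong {p} {q} p≈q (W₁.++-cong {u} {u′} {v} {v′} e e′)
      rewrite run-++ p u v | run-++ q u′ v′ | final-++ p u v | final-++ q u′ v′ =
      let (r , f) = run-cong p≈q e ; (r′ , f′) = run-cong f e′
      in W₂.++-cong r r′ , f′
    run-cong {p} p≈q (W₁.cancel a) =
      let (r , f) = run-backtrack p a (flip a) (W₁.≋-refl {flip a})
      in r , Q.trans f p≈q
    run-cong {p} p≈q (W₁.relator (y² j)) =
      let (r , f) = run-backtrack p (y j , pos) (y j , pos) (W₁.y-involution j)
      in r , Q.trans f p≈q

-- Translations between Schreier graphs.

module _ {𝕂 𝕁 : Set} {I₁ I₂ : Pred 𝕂 0ℓ} {J₁ J₂ : Pred 𝕁 0ℓ}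
         (H₁ : Subgroup (𝒢 I₁ J₁)) (H₂ : Subgroup (𝒢 I₂ J₂)) where
  private
    module W₁ = Words I₁ J₁
    module W₂ = Words I₂ J₂
    module G₁ = Group (𝒢 I₁ J₁)
    module G₂ = Group (𝒢 I₂ J₂)
    module H₁ = Subgroup H₁
    module H₂ = Subgroup H₂
    module C₁ = RightCosets H₁
    module C₂ = RightCosets H₂

  -- The effect of an isomorphism on the edges leaving each vertex. Images of vertices are not
  -- stored; they are recovered by reading words from the root.
  record LocalTranslation : Set where
    field
      τ : W₁.Word → Inverse W₁.letters W₂.letters

    τ⁺ : W₁.Word → W₁.Letter → W₂.Letter
    τ⁺ g = Inverse.to (τ g)

    τ⁻ : W₁.Word → W₂.Letter → W₁.Letter
    τ⁻ g = Inverse.from (τ g)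

    field
      τ-coset : ∀ g h → g C₁.∼ h → ∀ a → τ⁺ g a W₂.≋ τ⁺ h a
      τ-flip  : ∀ g a → τ⁺ (g ++ [ a ]) (flip a) W₂.≋ flip (τ⁺ g a)

    τ⁺τ⁻ : ∀ g b → τ⁺ g (τ⁻ g b) W₂.≋ b
    τ⁺τ⁻ g b = Inverse.inverseˡ (τ g) {b} {τ⁻ g b} (W₁.≋-refl {τ⁻ g b})

    τ⁻τ⁺ : ∀ g a → τ⁻ g (τ⁺ g a) W₁.≋ a
    τ⁻τ⁺ g a = Inverse.inverseʳ (τ g) {a} {τ⁺ g a} (W₂.≋-refl {τ⁺ g a})

    τ⁻-coset : ∀ g h → g C₁.∼ h → ∀ b → τ⁻ g b W₁.≋ τ⁻ h b
    τ⁻-coset g h g∼h b = Inverse.inverseʳ (τ g) {τ⁻ h b} {b} (begin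
      b                ≈⟨ τ⁺τ⁻ h b ⟨
      τ⁺ h (τ⁻ h b)    ≈⟨ τ-coset g h g∼h (τ⁻ h b) ⟨
      τ⁺ g (τ⁻ h b)    ∎)
      where open SetoidReasoning W₂.letters

    τ⁻-flip : ∀ g b → τ⁻ (g ++ [ τ⁻ g b ]) (flip b) W₁.≋ flip (τ⁻ g b)
    τ⁻-flip g b = Inverse.inverseʳ (τ (g ++ [ a ])) {flip a} {flip b} (begin
      flip b                      ≈⟨ W₂.flip-cong (τ⁺ g a) b (τ⁺τ⁻ g b) ⟨
      flip (τ⁺ g a)               ≈⟨ τ-flip g a ⟨
      τ⁺ (g ++ [ a ]) (flip a)    ∎)
      where
      open SetoidReasoning W₂.letters
      a = τ⁻ g b

    next-cong : ∀ g h a b → g C₁.∼ h → a W₁.≋ b → g ++ [ a ] C₁.∼ h ++ [ b ]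
    next-cong g h a b g∼h a≋b =
      C₁.∼-trans {g ++ [ a ]} {h ++ [ a ]} {h ++ [ b ]}
        (C₁.∙-congʳ-∼ g h [ a ] g∼h)
        (C₁.≈⇒∼ (W₁.++-cong (W₁.≈-refl {h}) (W₁.≋⇒≈ a b a≋b)))

    next-flip : ∀ g a b → b W₁.≋ flip a → (g ++ [ a ]) ++ [ b ] C₁.∼ g
    next-flip g a b b≋ā = C₁.≈⇒∼ (begin
      (g ++ [ a ]) ++ [ b ]      ≡⟨ ++-assoc g [ a ] [ b ] ⟩
      g ++ (a ∷ [ b ])           ≈⟨ G₁.∙-congˡ {g} (G₁.∙-congˡ {[ a ]} (W₁.≋⇒≈ b (flip a) b≋ā)) ⟩
      g ++ (a ∷ [ flip a ])      ≈⟨ G₁.∙-congˡ {g} (W₁.cancel a) ⟩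
      g ++ []                    ≡⟨ ++-identityʳ g ⟩
      g                          ∎)
      where open SetoidReasoning W₁.≈-setoid

    forward : Transducer I₁ I₂ J₁ J₂
    forward = record
      { states    = H₁.cosets
      ; next      = λ g a → g ++ [ a ]
      ; out       = τ⁺
      ; next-cong = λ {g} {h} → next-cong g h
      ; out-cong  = λ {g} {h} a b g∼h a≋b →
          W₂.≋-trans {τ⁺ g a} {τ⁺ h a} {τ⁺ h b}
            (τ-coset g h g∼h a) (Inverse.to-cong (τ h) {a} {b} a≋b)
      ; next-flip = λ g a → next-flip g a (flip a) (W₁.≋-refl {flip a})
      ; out-flip  = τ-flip
      }

    -- The inverse relabelling still keeps its state in Γ₁.
    backward : Transducer I₂ I₁ J₂ J₁
    backward = record
      { states    = H₁.cosets
      ; next      = λ g b → g ++ [ τ⁻ g b ]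
      ; out       = τ⁻
      ; next-cong = λ {g} {h} a b g∼h a≋b →
          next-cong g h (τ⁻ g a) (τ⁻ h b) g∼h (τ⁻-cong {g} {h} a b g∼h a≋b)
      ; out-cong  = λ {g} {h} → τ⁻-cong {g} {h}
      ; next-flip = λ g b → next-flip g (τ⁻ g b) (τ⁻ (g ++ [ τ⁻ g b ]) (flip b)) (τ⁻-flip g b)
      ; out-flip  = τ⁻-flip
      }
      where
      τ⁻-cong : ∀ {g h} a b → g C₁.∼ h → a W₂.≋ b → τ⁻ g a W₁.≋ τ⁻ h b
      τ⁻-cong {g} {h} a b g∼h a≋b =
        W₁.≋-trans {τ⁻ g a} {τ⁻ h a} {τ⁻ h b}
          (τ⁻-coset g h g∼h a) (Inverse.from-cong (τ h) {a} {b} a≋b)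

    module F = Transducer forward
    module B = Transducer backward

    T : W₁.Word → W₁.Word → W₂.Word
    T = F.run

    T⁻ : W₁.Word → W₂.Word → W₁.Word
    T⁻ = B.run

    T-congʳ : ∀ g {u v} → u W₁.≈ v → T g u W₂.≈ T g v
    T-congʳ g u≈v = proj₁ (F.run-cong (C₁.∼-refl {g}) u≈v)

    T⁻-congʳ : ∀ g {u v} → u W₂.≈ v → T⁻ g u W₁.≈ T⁻ g v
    T⁻-congʳ g u≈v = proj₁ (B.run-cong (C₁.∼-refl {g}) u≈v)

    T-++ : ∀ g u v → T g (u ++ v) ≡ T g u ++ T (g ++ u) v
    T-++ g u v = trans (F.run-++ g u v) (cong (λ h → T g u ++ T h v) (final≡ g u))
      where
      final≡ : ∀ g u → F.final g u ≡ g ++ u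
      final≡ g []      = sym (++-identityʳ g)
      final≡ g (a ∷ u) = trans (final≡ (g ++ [ a ]) u) (++-assoc g [ a ] u)

    T⁻-++ : ∀ g u v → T⁻ g (u ++ v) ≡ T⁻ g u ++ T⁻ (g ++ T⁻ g u) v
    T⁻-++ g u v = trans (B.run-++ g u v) (cong (λ h → T⁻ g u ++ T⁻ h v) (final≡ g u))
      where
      final≡ : ∀ g u → B.final g u ≡ g ++ T⁻ g u
      final≡ g []      = sym (++-identityʳ g)
      final≡ g (a ∷ u) =
        trans (final≡ (g ++ [ τ⁻ g a ]) u) (++-assoc g [ τ⁻ g a ] (T⁻ (g ++ [ τ⁻ g a ]) u))

    T∘T⁻ : ∀ g w → T g (T⁻ g w) W₂.≈ w
    T∘T⁻ g []      = W₂.≈-refl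
    T∘T⁻ g (b ∷ w) =
      W₂.∷-cong (τ⁺ g (τ⁻ g b)) b (τ⁺τ⁻ g b) (T∘T⁻ (g ++ [ τ⁻ g b ]) w)

    -- After one letter the inverse transducer is at `g ++ [ τ⁻ g (τ⁺ g a) ]`, which only lies in
    -- the coset of `g ++ [ a ]`; `run-congˡ` changes the state before the induction hypothesis
    -- applies.
    T⁻∘T : ∀ g w → T⁻ g (T g w) W₁.≈ w
    T⁻∘T g []      = W₁.≈-refl
    T⁻∘T g (a ∷ w) = W₁.∷-cong (τ⁻ g (τ⁺ g a)) a (τ⁻τ⁺ g a) (W₁.≈-trans
      (proj₁ (B.run-congˡ {g ++ [ τ⁻ g (τ⁺ g a) ]} {g ++ [ a ]} (T (g ++ [ a ]) w)
        (next-cong g g (τ⁻ g (τ⁺ g a)) a (C₁.∼-refl {g}) (τ⁻τ⁺ g a))))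
      (T⁻∘T (g ++ [ a ]) w))

    length-T : ∀ g w → length (T g w) ≡ length w
    length-T = F.length-run

    length-T⁻ : ∀ g w → length (T⁻ g w) ≡ length w
    length-T⁻ = B.length-run

  -- A path from the root closes up exactly when its word lies in the subgroup, so `T-∈` makes
  -- closed paths at the two roots correspond.
  record Translation : Set where
    field
      local : LocalTranslation
    open LocalTranslation local public
    field
      T-∈ : ∀ w → w ∈ H₁.Member ⇔ T [] w ∈ H₂.Member

    T⁻-∈ : ∀ {w} → w ∈ H₂.Member → T⁻ [] w ∈ H₁.Member
    T⁻-∈ {w} w∈H₂ =
      Equivalence.from (T-∈ (T⁻ [] w)) (H₂.resp (W₂.≈-sym (T∘T⁻ [] w)) w∈H₂)

    -- Reading `h` leads back to the root, so `w` is translated from there again. Thus `T []` is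
    -- multiplicative on `H₁`.
    T-∈-++ : ∀ h w → h ∈ H₁.Member → T [] (h ++ w) W₂.≈ T [] h ++ T [] w
    T-∈-++ h w h∈H₁ = W₂.≈-trans (W₂.≡⇒≈ (T-++ [] h w))
      (G₂.∙-congˡ {T [] h} (proj₁ (F.run-congˡ w (C₁.∈⇒∼ε h∈H₁))))

    T⁻-∈-++ : ∀ h w → h ∈ H₂.Member → T⁻ [] (h ++ w) W₁.≈ T⁻ [] h ++ T⁻ [] w
    T⁻-∈-++ h w h∈H₂ = W₁.≈-trans (W₁.≡⇒≈ (T⁻-++ [] h w))
      (G₁.∙-congˡ {T⁻ [] h} (proj₁ (B.run-congˡ w (C₁.∈⇒∼ε (T⁻-∈ h∈H₂)))))

    lengthIsomorphic : LengthIsomorphic (𝒳 I₁ J₁) (𝒳 I₂ J₂) H₁ H₂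
    lengthIsomorphic = α ,
      record
        { isGroupMonomorphism = record
          { isGroupHomomorphism = record
            { isMonoidHomomorphism = record
              { isMagmaHomomorphism = record
                { isRelHomomorphism = record { cong = T-congʳ [] }
                ; homo              = λ (g , g∈H₁) (h , _) → T-∈-++ g h g∈H₁
                }
              ; ε-homo = W₂.≈-refl
              }
            ; ⁻¹-homo = λ (g , g∈H₁) → inverseˡ-unique (T [] (g W₁.⁻¹)) (T [] g) (begin
                T [] (g W₁.⁻¹) ++ T [] g   ≈⟨ T-∈-++ (g W₁.⁻¹) g (H₁.⁻¹-closed g∈H₁) ⟨
                T [] (g W₁.⁻¹ ++ g)        ≈⟨ T-congʳ [] (G₁.inverseˡ g) ⟩
                []                         ∎)
            }
          ; injective = λ {(g , _)} {(h , _)} → T-injective {g} {h}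
          }
        ; surjective = λ (u , u∈H₂) → (T⁻ [] u , T⁻-∈ u∈H₂) ,
            λ w≈T⁻u → W₂.≈-trans (T-congʳ [] w≈T⁻u) (T∘T⁻ [] u)
        } ,
      λ (h , _) n → mk⇔ (preserves-length h n) (reflects-length h n)
      where
      open GroupProperties (𝒢 I₂ J₂)
      open SetoidReasoning W₂.≈-setoid

      α : ∃[ h ] h ∈ H₁.Member → ∃[ h ] h ∈ H₂.Member
      α (h , h∈H₁) = T [] h , Equivalence.to (T-∈ h) h∈H₁

      T-injective : ∀ {g h} → T [] g W₂.≈ T [] h → g W₁.≈ h
      T-injective {g} {h} Tg≈Th =
        W₁.≈-trans (W₁.≈-sym (T⁻∘T [] g)) (W₁.≈-trans (T⁻-congʳ [] Tg≈Th) (T⁻∘T [] h))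

      preserves-length : ∀ h n → W₁.HasLength h n → W₂.HasLength (T [] h) n
      preserves-length h n ((w , |w|≡n , w≈h) , n≤) =
        (T [] w , trans (length-T [] w) |w|≡n ,
          W₂.≈-trans (W₂.≡⇒≈ (W₂.∏≡id (T [] w)))
            (T-congʳ [] (W₁.≈-trans (W₁.≡⇒≈ (sym (W₁.∏≡id w))) w≈h))) ,
        -- For the lower bound, `T⁻ []` turns a word for `T [] h` into one of the same length for
        -- `h`.
        λ v v≈Th → subst (n ≤_) (length-T⁻ [] v) (n≤ (T⁻ [] v)
          (W₁.≈-trans (W₁.≡⇒≈ (W₁.∏≡id (T⁻ [] v))) (W₁.≈-trans
            (T⁻-congʳ [] (W₂.≈-trans (W₂.≡⇒≈ (sym (W₂.∏≡id v))) v≈Th))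
            (T⁻∘T [] h))))

      reflects-length : ∀ h n → W₂.HasLength (T [] h) n → W₁.HasLength h n
      reflects-length h n ((v , |v|≡n , v≈Th) , n≤) =
        (T⁻ [] v , trans (length-T⁻ [] v) |v|≡n ,
          W₁.≈-trans (W₁.≡⇒≈ (W₁.∏≡id (T⁻ [] v))) (W₁.≈-trans
            (T⁻-congʳ [] (W₂.≈-trans (W₂.≡⇒≈ (sym (W₂.∏≡id v))) v≈Th))
            (T⁻∘T [] h))) ,
        λ w w≈h → subst (n ≤_) (length-T [] w) (n≤ (T [] w)
          (W₂.≈-trans (W₂.≡⇒≈ (W₂.∏≡id (T [] w)))
            (T-congʳ [] (W₁.≈-trans (W₁.≡⇒≈ (sym (W₁.∏≡id w))) w≈h))))

    sameDegree : SameDegree (𝒳 I₁ J₁) (𝒳 I₂ J₂)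
    sameDegree = Composition.inverse (star≅letters (𝒳 I₁ J₁))
      (Composition.inverse (τ []) (Symmetry.inverse (star≅letters (𝒳 I₂ J₂))))

    private
      -- Since `g` is `k h` with `k` in `H₁`, its translation splits into `T [] k`, which lies in
      -- `H₂`, and `T [] h`.
      T-∼ : ∀ g h → g C₁.∼ h → T [] g C₂.∼ T [] h
      T-∼ g h g∼h = C₂.∼-trans {T [] g} {T [] (k ++ h)} {T [] h}
        (C₂.≈⇒∼ (T-congʳ [] (W₁.≈-sym (//-rightDividesˡ h g))))
        (C₂.∼-trans {T [] (k ++ h)} {T [] k ++ T [] h} {T [] h}
          (C₂.≈⇒∼ (T-∈-++ k h g∼h))
          (C₂.∈⇒∙∼ (T [] h) (Equivalence.to (T-∈ k) g∼h)))
        where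
        k = g ++ h W₁.⁻¹
        open GroupProperties (𝒢 I₁ J₁)

      T⁻-∼ : ∀ g h → g C₂.∼ h → T⁻ [] g C₁.∼ T⁻ [] h
      T⁻-∼ g h g∼h = C₁.∼-trans {T⁻ [] g} {T⁻ [] (k ++ h)} {T⁻ [] h}
        (C₁.≈⇒∼ (T⁻-congʳ [] (W₂.≈-sym (//-rightDividesˡ h g))))
        (C₁.∼-trans {T⁻ [] (k ++ h)} {T⁻ [] k ++ T⁻ [] h} {T⁻ [] h}
          (C₁.≈⇒∼ (T⁻-∈-++ k h g∼h))
          (C₁.∈⇒∙∼ (T⁻ [] h) (T⁻-∈ g∼h)))
        where
        k = g ++ h W₂.⁻¹
        open GroupProperties (𝒢 I₂ J₂)

    onVertices : Inverse H₁.cosets H₂.cosets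
    onVertices = record
      { to        = T []
      ; from      = T⁻ []
      ; to-cong   = λ {g} {h} → T-∼ g h
      ; from-cong = λ {g} {h} → T⁻-∼ g h
      ; inverse   =
          (λ {u} {g} g∼T⁻u → C₂.∼-trans {T [] g} {T [] (T⁻ [] u)} {u}
            (T-∼ g (T⁻ [] u) g∼T⁻u) (C₂.≈⇒∼ (T∘T⁻ [] u))) ,
          (λ {g} {u} u∼Tg → C₁.∼-trans {T⁻ [] u} {T⁻ [] (T [] g)} {g}
            (T⁻-∼ u (T [] g) u∼Tg) (C₁.≈⇒∼ (T⁻∘T [] g)))
      }

    onEdges : Inverse (Graph.edges (Γ I₁ J₁ H₁)) (Graph.edges (Γ I₂ J₂ H₂))
    onEdges = record
      { to        = λ (g , a) → T [] g , τ⁺ g a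
      ; from      = λ (u , b) → T⁻ [] u , τ⁻ (T⁻ [] u) b
      ; to-cong   = λ { {g , a} {h , b} (g∼h , a≋b) →
          T-∼ g h g∼h , F.out-cong {g} {h} a b g∼h a≋b }
      ; from-cong = λ { {u , a} {v , b} (u∼v , a≋b) → T⁻-∼ u v u∼v ,
          B.out-cong {T⁻ [] u} {T⁻ [] v} a b (T⁻-∼ u v u∼v) a≋b }
      ; inverse   =
          (λ { {u , b} {g , a} (g∼T⁻u , a≋τ⁻b) →
            Inverse.inverseˡ onVertices {u} {g} g∼T⁻u ,
            W₂.≋-trans {τ⁺ g a} {τ⁺ (T⁻ [] u) (τ⁻ (T⁻ [] u) b)} {b}
              (F.out-cong {g} {T⁻ [] u} a (τ⁻ (T⁻ [] u) b) g∼T⁻u a≋τ⁻b)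
              (τ⁺τ⁻ (T⁻ [] u) b) }) ,
          (λ { {g , a} {u , b} (u∼Tg , b≋τa) →
            Inverse.inverseʳ onVertices {g} {u} u∼Tg ,
            W₁.≋-trans {τ⁻ (T⁻ [] u) b} {τ⁻ g (τ⁺ g a)} {a}
              (B.out-cong {T⁻ [] u} {g} b (τ⁺ g a)
                (Inverse.inverseʳ onVertices {g} {u} u∼Tg) b≋τa)
              (τ⁻τ⁺ g a) })
      }

    isomorphism : GraphIsomorphism (Γ I₁ J₁ H₁) (Γ I₂ J₂ H₂)
    isomorphism = record
      { onVertices  = onVertices
      ; onEdges     = onEdges
      ; ι-commute   = λ (g , _) → C₂.∼-refl {T [] g}
      ; inv-commute = λ (g , a) →
          C₂.≈⇒∼ (W₂.≡⇒≈ (trans (cong (T [] g ++_) (W₂.⟦⟧≡[] (τ⁺ g a)))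
            (trans (sym (T-++ [] g [ a ])) (cong (T [] ∘ (g ++_)) (sym (W₁.⟦⟧≡[] a)))))) ,
          W₂.≋-sym {τ⁺ (g ++ W₁.⟦ a ⟧) (flip a)} {flip (τ⁺ g a)}
            (subst (λ w → τ⁺ (g ++ w) (flip a) W₂.≋ flip (τ⁺ g a)) (sym (W₁.⟦⟧≡[] a))
              (τ-flip g a))
      }

  -- From rooted isomorphisms to translations.

  module _ (f : GraphIsomorphism (Γ I₁ J₁ H₁) (Γ I₂ J₂ H₂)) where
    open GraphIsomorphism f
    private
      module V = Inverse onVertices
      module E = Inverse onEdges

      mapᵛ-injective : ∀ g h → mapᵛ g C₂.∼ mapᵛ h → g C₁.∼ h
      mapᵛ-injective g h fg∼fh = C₁.∼-trans {g} {V.from (mapᵛ h)} {h}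
        (C₁.∼-sym {V.from (mapᵛ h)} {g}
          (V.inverseʳ {g} {mapᵛ h} (C₂.∼-sym {mapᵛ g} {mapᵛ h} fg∼fh)))
        (V.inverseʳ {h} {mapᵛ h} (C₂.∼-refl {mapᵛ h}))

      -- By `ι-commute` and injectivity on vertices. This ties the inverse of the edge map to the
      -- vertex `g`, so that it inverts the letter map there.
      initial⁻ : ∀ g b → proj₁ (E.from (mapᵛ g , b)) C₁.∼ g
      initial⁻ g b = mapᵛ-injective g′ g (C₂.∼-trans {mapᵛ g′} {proj₁ (mapᵉ e)} {mapᵛ g}
        (C₂.∼-sym {proj₁ (mapᵉ e)} {mapᵛ g′} (ι-commute e))
        (proj₁ (E.inverseˡ {mapᵛ g , b} {e} (C₁.∼-refl {g′} , W₁.≋-refl {proj₂ e}))))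
        where
        e = E.from (mapᵛ g , b)
        g′ = proj₁ e

    isomorphism⇒local : LocalTranslation
    isomorphism⇒local = record
      { τ       = λ g → record
        { to        = λ a → proj₂ (mapᵉ (g , a))
        ; from      = λ b → proj₂ (E.from (mapᵛ g , b))
        ; to-cong   = λ {a} {b} a≋b → proj₂ (E.to-cong {g , a} {g , b} (C₁.∼-refl {g} , a≋b))
        ; from-cong = λ {a} {b} a≋b →
            proj₂ (E.from-cong {mapᵛ g , a} {mapᵛ g , b} (C₂.∼-refl {mapᵛ g} , a≋b))
        ; inverse   =
            (λ {b} {a} a≋ → proj₂ (E.inverseˡ {mapᵛ g , b} {g , a}
              (C₁.∼-sym {proj₁ (E.from (mapᵛ g , b))} {g} (initial⁻ g b) , a≋))) ,
            (λ {a} {b} b≋ → proj₂ (E.inverseʳ {g , a} {mapᵛ g , b}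
              (C₂.∼-sym {proj₁ (mapᵉ (g , a))} {mapᵛ g} (ι-commute (g , a)) , b≋)))
        }
      ; τ-coset = λ g h g∼h a → proj₂ (E.to-cong {g , a} {h , a} (g∼h , W₁.≋-refl {a}))
      ; τ-flip  = λ g a → subst
          (λ w → proj₂ (mapᵉ (g ++ w , flip a)) W₂.≋ flip (proj₂ (mapᵉ (g , a))))
          (W₁.⟦⟧≡[] a)
          (W₂.≋-sym {flip (proj₂ (mapᵉ (g , a)))} {proj₂ (mapᵉ (g ++ W₁.⟦ a ⟧ , flip a))}
            (proj₂ (inv-commute (g , a))))
      }

    private
      open LocalTranslation isomorphism⇒local

      -- The end of an edge is the start of its inverse edge, so `inv-commute` followed by
      -- `ι-commute` locates its image.
      mapᵛ-step : ∀ g a → mapᵛ g ++ [ τ⁺ g a ] C₂.∼ mapᵛ (g ++ [ a ])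
      mapᵛ-step g a = begin
        mapᵛ g ++ [ τ⁺ g a ]
          ≈⟨ C₂.∙-congʳ-∼ (proj₁ e) (mapᵛ g) [ τ⁺ g a ] (ι-commute (g , a)) ⟨
        proj₁ e ++ [ τ⁺ g a ]
          ≡⟨ cong (proj₁ e ++_) (W₂.⟦⟧≡[] (τ⁺ g a)) ⟨
        proj₁ e ++ W₂.⟦ τ⁺ g a ⟧
          ≈⟨ proj₁ (inv-commute (g , a)) ⟩
        proj₁ (mapᵉ (g ++ W₁.⟦ a ⟧ , flip a))
          ≈⟨ ι-commute (g ++ W₁.⟦ a ⟧ , flip a) ⟩
        mapᵛ (g ++ W₁.⟦ a ⟧)
          ≡⟨ cong (λ w → mapᵛ (g ++ w)) (W₁.⟦⟧≡[] a) ⟩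
        mapᵛ (g ++ [ a ]) ∎
        where
        open SetoidReasoning H₂.cosets
        e = mapᵉ (g , a)

      mapᵛ-++ : ∀ g w → mapᵛ g ++ T g w C₂.∼ mapᵛ (g ++ w)
      mapᵛ-++ g []      = C₂.≈⇒∼ (W₂.≡⇒≈
        (trans (++-identityʳ (mapᵛ g)) (cong mapᵛ (sym (++-identityʳ g)))))
      mapᵛ-++ g (a ∷ w) = begin
        mapᵛ g ++ (τ⁺ g a ∷ T (g ++ [ a ]) w)
          ≡⟨ ++-assoc (mapᵛ g) [ τ⁺ g a ] (T (g ++ [ a ]) w) ⟨
        (mapᵛ g ++ [ τ⁺ g a ]) ++ T (g ++ [ a ]) w
          ≈⟨ C₂.∙-congʳ-∼ (mapᵛ g ++ [ τ⁺ g a ]) (mapᵛ (g ++ [ a ])) (T (g ++ [ a ]) w)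
               (mapᵛ-step g a) ⟩
        mapᵛ (g ++ [ a ]) ++ T (g ++ [ a ]) w
          ≈⟨ mapᵛ-++ (g ++ [ a ]) w ⟩
        mapᵛ ((g ++ [ a ]) ++ w)
          ≡⟨ cong mapᵛ (++-assoc g [ a ] w) ⟩
        mapᵛ (g ++ a ∷ w) ∎
        where open SetoidReasoning H₂.cosets

    -- As `T [] w` represents the coset `mapᵛ w`, it lies in `H₂` exactly when `mapᵛ` sends `w` to
    -- the root, and `mapᵛ` is injective on cosets.
    isomorphism⇒translation : mapᵛ [] C₂.∼ [] → Translation
    isomorphism⇒translation f[]∼[] = record
      { local = isomorphism⇒local
      ; T-∈   = λ w → mk⇔
          (λ w∈H₁ → C₂.∼ε⇒∈ (begin
            T [] w    ≈⟨ T∼ w ⟩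
            mapᵛ w    ≈⟨ V.to-cong {w} {[]} (C₁.∈⇒∼ε w∈H₁) ⟩
            mapᵛ []   ≈⟨ f[]∼[] ⟩
            []        ∎))
          (λ Tw∈H₂ → C₁.∼ε⇒∈ (mapᵛ-injective w [] (begin
            mapᵛ w    ≈⟨ T∼ w ⟨
            T [] w    ≈⟨ C₂.∈⇒∼ε Tw∈H₂ ⟩
            []        ≈⟨ f[]∼[] ⟨
            mapᵛ []   ∎)))
      }
      where
      open SetoidReasoning H₂.cosets
      T∼ : ∀ w → T [] w C₂.∼ mapᵛ w
      T∼ w = begin
        T [] w              ≈⟨ C₂.∙-congʳ-∼ (mapᵛ []) [] (T [] w) f[]∼[] ⟨
        mapᵛ [] ++ T [] w   ≈⟨ mapᵛ-++ [] w ⟩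
        mapᵛ w              ∎

  LabelPreservingTranslation : Set
  LabelPreservingTranslation =
    Σ[ t ∈ Translation ] (∀ g a → label (Translation.τ⁺ t g a) ≡ label a)

-- Label-preserving isomorphisms and equality of subgroups.

module _ {𝕂 𝕁 : Set} {I₁ I₂ : Pred 𝕂 0ℓ} {J₁ J₂ : Pred 𝕁 0ℓ}
         (I⊆ : I₁ ⊆ I₂) (J⊆ : J₁ ⊆ J₂) where

  renameLetter : Signed (Generator I₁ J₁) → Signed (Generator I₂ J₂)
  renameLetter = map₁ (Sum.map (refine I⊆) (refine J⊆))

  label-renameLetter : ∀ a → label (renameLetter a) ≡ label a
  label-renameLetter (x _ , _) = refl
  label-renameLetter (y _ , _) = refl

module _ {𝕂 𝕁 : Set} {I : Pred 𝕂 0ℓ} {J : Pred 𝕁 0ℓ} where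

  -- Excluded middle recovers a membership proof from the irrelevant one.
  label-x⇒∈ : ExcludedMiddle 0ℓ → ∀ {k s} (a : Signed (Generator I J)) →
              label a ≡ inj₁ (k , s) → I k
  label-x⇒∈ em (x (_ , irr i) , _) refl = recompute em i

  label-y⇒∈ : ExcludedMiddle 0ℓ → ∀ {j} (a : Signed (Generator I J)) →
              label a ≡ inj₂ j → J j
  label-y⇒∈ em (y (_ , irr i) , _) refl = recompute em i

module _ {𝕂 𝕁 : Set} {I₁ I₂ : Pred 𝕂 0ℓ} {J₁ J₂ : Pred 𝕁 0ℓ}
         (H₁ : Subgroup (𝒢 I₁ J₁)) (H₂ : Subgroup (𝒢 I₂ J₂)) where
  private
    module W₁ = Words I₁ J₁
    module W₂ = Words I₂ J₂

  -- Each generator of one group, translated at the root, becomes a letter of the other with the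
  -- same label, so the index sets agree. As labels determine letters, `T` is then `rename`.
  translation⇒equal : ExcludedMiddle 0ℓ →
                      LabelPreservingTranslation H₁ H₂ → EqualSubgroups H₁ H₂
  translation⇒equal em (t , label-τ) = (I⊆ , I⊇) , (J⊆ , J⊇) , λ w → mk⇔
    (λ w∈H₁ → Subgroup.resp H₂ (T≈rename [] w) (Equivalence.to (T-∈ w) w∈H₁))
    (λ w∈H₂ → Equivalence.from (T-∈ w) (Subgroup.resp H₂ (W₂.≈-sym (T≈rename [] w)) w∈H₂))
    where
    open Translation t

    label-τ⁻ : ∀ b → label (τ⁻ [] b) ≡ label b
    label-τ⁻ b = trans (sym (label-τ [] (τ⁻ [] b)))
      (W₂.label-cong (τ⁺ [] (τ⁻ [] b)) b (τ⁺τ⁻ [] b))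

    I⊆ : I₁ ⊆ I₂
    I⊆ {k} i = label-x⇒∈ em (τ⁺ [] a) (label-τ [] a)
      where a = x (k , irr i) , pos

    I⊇ : I₂ ⊆ I₁
    I⊇ {k} i = label-x⇒∈ em (τ⁻ [] b) (label-τ⁻ b)
      where b = x (k , irr i) , pos

    J⊆ : J₁ ⊆ J₂
    J⊆ {j} i = label-y⇒∈ em (τ⁺ [] a) (label-τ [] a)
      where a = y (j , irr i) , pos

    J⊇ : J₂ ⊆ J₁
    J⊇ {j} i = label-y⇒∈ em (τ⁻ [] b) (label-τ⁻ b)
      where b = y (j , irr i) , pos

    T≈rename : ∀ g w → T g w W₂.≈ rename I⊆ J⊆ w
    T≈rename g []      = W₂.≈-refl
    T≈rename g (a ∷ w) = W₂.∷-cong (τ⁺ g a) (ρ a)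
      (W₂.label-injective (τ⁺ g a) (ρ a)
        (trans (label-τ g a) (sym (label-renameLetter I⊆ J⊆ a))))
      (T≈rename (g ++ [ a ]) w)
      where ρ = renameLetter I⊆ J⊆

  equal⇒translation : EqualSubgroups H₁ H₂ → LabelPreservingTranslation H₁ H₂
  equal⇒translation ((I⊆ , I⊇) , (J⊆ , J⊇) , H₁⇔H₂) =
    record
      { local = local
      ; T-∈   = λ w → subst (λ u → w ∈ Subgroup.Member H₁ ⇔ u ∈ Subgroup.Member H₂)
          (sym (T≡rename [] w)) (H₁⇔H₂ w)
      } ,
    λ _ → label-ρ
    where
    ρ  = renameLetter I⊆ J⊆
    ρ⁻ = renameLetter I⊇ J⊇
    label-ρ  = label-renameLetter I⊆ J⊆
    label-ρ⁻ = label-renameLetter I⊇ J⊇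

    ρ↔ : Inverse W₁.letters W₂.letters
    ρ↔ = record
      { to        = ρ
      ; from      = ρ⁻
      ; to-cong   = λ {a} {b} a≋b → W₂.label-injective (ρ a) (ρ b)
          (trans (label-ρ a) (trans (W₁.label-cong a b a≋b) (sym (label-ρ b))))
      ; from-cong = λ {a} {b} a≋b → W₁.label-injective (ρ⁻ a) (ρ⁻ b)
          (trans (label-ρ⁻ a) (trans (W₂.label-cong a b a≋b) (sym (label-ρ⁻ b))))
      ; inverse   =
          (λ {b} {a} a≋ρ⁻b → W₂.label-injective (ρ a) b
            (trans (label-ρ a) (trans (W₁.label-cong a (ρ⁻ b) a≋ρ⁻b) (label-ρ⁻ b)))) ,
          (λ {a} {b} b≋ρa → W₁.label-injective (ρ⁻ b) a
            (trans (label-ρ⁻ b) (trans (W₂.label-cong b (ρ a) b≋ρa) (label-ρ a))))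
      }

    local : LocalTranslation H₁ H₂
    local = record
      { τ       = λ _ → ρ↔
      ; τ-coset = λ _ _ _ a → W₂.≋-refl {ρ a}
      ; τ-flip  = λ _ a → W₂.≋-refl {flip (ρ a)}
      }

    T≡rename : ∀ g w → LocalTranslation.T local g w ≡ rename I⊆ J⊆ w
    T≡rename g []      = refl
    T≡rename g (a ∷ w) = cong (ρ a ∷_) (T≡rename (g ++ [ a ]) w)

  labelIsomorphic⇔equal : ExcludedMiddle 0ℓ →
                          RootedLabelIsomorphic H₁ H₂ ⇔ EqualSubgroups H₁ H₂
  labelIsomorphic⇔equal em = mk⇔
    (λ (f , label-f , root-f) → translation⇒equal em
      (isomorphism⇒translation H₁ H₂ f root-f , λ g a → label-f (g , a)))
    (λ H₁≡H₂ → let (t , label-τ) = equal⇒translation H₁≡H₂ in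
      Translation.isomorphism t , (λ (g , a) → label-τ g a) , RightCosets.∼-refl H₂ {[]})

-- Normal forms and geodesics in finite degree.

module NormalForm {𝕂 𝕁 : Set} (I : Pred 𝕂 0ℓ) (J : Pred 𝕁 0ℓ) {d : ℕ}
                  (code : Inverse (Words.letters I J) (setoid (Fin d))) where
  open Words I J

  ⌜_⌝ : Letter → Fin d
  ⌜_⌝ = Inverse.to code

  ⌞_⌟ : Fin d → Letter
  ⌞_⌟ = Inverse.from code

  ⌜⌞⌟⌝ : ∀ i → ⌜ ⌞ i ⌟ ⌝ ≡ i
  ⌜⌞⌟⌝ i = Inverse.inverseˡ code {i} {⌞ i ⌟} (≋-refl {⌞ i ⌟})

  ⌞⌜⌝⌟ : ∀ a → ⌞ ⌜ a ⌝ ⌟ ≋ a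
  ⌞⌜⌝⌟ a = Inverse.inverseʳ code {a} {⌜ a ⌝} refl

  ⌜⌝-cong : ∀ a b → a ≋ b → ⌜ a ⌝ ≡ ⌜ b ⌝
  ⌜⌝-cong a b = Inverse.to-cong code {a} {b}

  -- Inversion on codes. The codes of the `y j` are fixed points, so the single condition
  -- `j ≢ bar i` excludes both free cancellation and the relators.
  bar : Fin d → Fin d
  bar i = ⌜ flip ⌞ i ⌟ ⌝

  ⌜flip⌝ : ∀ a → ⌜ flip a ⌝ ≡ bar ⌜ a ⌝
  ⌜flip⌝ a = sym (⌜⌝-cong (flip ⌞ ⌜ a ⌝ ⌟) (flip a) (flip-cong ⌞ ⌜ a ⌝ ⌟ a (⌞⌜⌝⌟ a)))

  bar-involutive : ∀ i → bar (bar i) ≡ i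
  bar-involutive i =
    trans (sym (⌜flip⌝ (flip ⌞ i ⌟)))
      (trans (cong ⌜_⌝ (flip-involutive ⌞ i ⌟)) (⌜⌞⌟⌝ i))

  ⌞bar⌟ : ∀ i → ⌞ bar i ⌟ ≋ flip ⌞ i ⌟
  ⌞bar⌟ i = ⌞⌜⌝⌟ (flip ⌞ i ⌟)

  Code : Set
  Code = List (Fin d)

  Reduced : Code → Set
  Reduced = Linked (λ i j → j ≢ bar i)

  push : Fin d → Code → Code
  push i []      = [ i ]
  push i (j ∷ r) with j ≟ bar i
  ... | yes _ = r
  ... | no  _ = i ∷ j ∷ r

  push-cancel : ∀ i j r → j ≡ bar i → push i (j ∷ r) ≡ r
  push-cancel i j r j≡ with j ≟ bar i
  ... | yes _ = refl
  ... | no ¬p = contradiction j≡ ¬p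

  push-∷ : ∀ i r → head r ≢ just (bar i) → push i r ≡ i ∷ r
  push-∷ i []      _ = refl
  push-∷ i (j ∷ r) h with j ≟ bar i
  ... | yes p = contradiction (cong just p) h
  ... | no  _ = refl

  reduced-head : ∀ {i r} → Reduced (i ∷ r) → head r ≢ just (bar i)
  reduced-head (h ∷ _) refl = h refl

  reduced-∷ : ∀ {i r} → head r ≢ just (bar i) → Reduced r → Reduced (i ∷ r)
  reduced-∷ {r = []}    _ _ = [-]
  reduced-∷ {r = j ∷ r} h p = (λ j≡ → h (cong just j≡)) ∷ p

  push-reduced : ∀ i {r} → Reduced r → Reduced (push i r)
  push-reduced i {[]}    _ = [-]
  push-reduced i {j ∷ r} p with j ≟ bar i
  ... | yes _ = Linked.tail p
  ... | no ¬q = ¬q ∷ p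

  -- If the word starts with `i`, then `bar i` removes that letter, and `push i` puts it back
  -- because the next letter of a reduced word is not `bar i`.
  push-bar : ∀ i {r} → Reduced r → push i (push (bar i) r) ≡ r
  push-bar i {[]}    _ = push-cancel i (bar i) [] refl
  push-bar i {j ∷ r} p with j ≟ bar (bar i)
  ... | no  _ = push-cancel i (bar i) (j ∷ r) refl
  ... | yes q with refl ← trans q (bar-involutive i) = push-∷ i r (reduced-head p)

  length-push : ∀ i r → length (push i r) ≤ ℕ.suc (length r)
  length-push i []      = ≤-refl
  length-push i (j ∷ r) with j ≟ bar i
  ... | yes _ = m≤n⇒m≤1+n (n≤1+n _)
  ... | no  _ = ≤-refl

  -- Van der Waerden's method: letters act on reduced words by left multiplication, and since this
  -- action respects the relations, normal forms are unique.
  act : Word → Code → Code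
  act w r = foldr (λ a → push ⌜ a ⌝) r w

  reduce : Word → Code
  reduce w = act w []

  ∣_∣ : Word → ℕ
  ∣ w ∣ = length (reduce w)

  embed : Code → Word
  embed = map ⌞_⌟

  act-reduced : ∀ w {r} → Reduced r → Reduced (act w r)
  act-reduced []      p = p
  act-reduced (a ∷ w) p = push-reduced ⌜ a ⌝ (act-reduced w p)

  reduce-reduced : ∀ w → Reduced (reduce w)
  reduce-reduced w = act-reduced w []

  act-++ : ∀ u v r → act (u ++ v) r ≡ act u (act v r)
  act-++ u v r = foldr-++ _ r u v

  act-backtrack : ∀ a b → b ≋ flip a → ∀ {r} → Reduced r → act (a ∷ b ∷ []) r ≡ r
  act-backtrack a b b≋ā {r} p =
    trans (cong (λ i → push ⌜ a ⌝ (push i r)) (trans (⌜⌝-cong b (flip a) b≋ā) (⌜flip⌝ a)))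
      (push-bar ⌜ a ⌝ p)

  act-cong : ∀ {u v} → u ≈ v → ∀ {r} → Reduced r → act u r ≡ act v r
  act-cong ≈-refl        p = refl
  act-cong (≈-sym e)     p = sym (act-cong e p)
  act-cong (≈-trans e f) p = trans (act-cong e p) (act-cong f p)
  act-cong (++-cong {u} {u′} {v} {v′} e f) {r} p = begin
    act (u ++ v) r      ≡⟨ act-++ u v r ⟩
    act u (act v r)     ≡⟨ cong (act u) (act-cong f p) ⟩
    act u (act v′ r)    ≡⟨ act-cong e (act-reduced v′ p) ⟩
    act u′ (act v′ r)   ≡⟨ act-++ u′ v′ r ⟨
    act (u′ ++ v′) r    ∎
    where open ≡-Reasoning
  act-cong (cancel a)       p = act-backtrack a (flip a) (≋-refl {flip a}) p
  act-cong (relator (y² j)) p = act-backtrack (y j , pos) (y j , pos) (y-involution j) p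

  reduce-cong : ∀ {u v} → u ≈ v → reduce u ≡ reduce v
  reduce-cong e = act-cong e []

  ∣∣-cong : ∀ {u v} → u ≈ v → ∣ u ∣ ≡ ∣ v ∣
  ∣∣-cong e = cong length (reduce-cong e)

  embed-push : ∀ i r → embed (push i r) ≈ ⌞ i ⌟ ∷ embed r
  embed-push i []      = ≈-refl
  embed-push i (j ∷ r) with j ≟ bar i
  ... | no  _    = ≈-refl
  ... | yes refl = ≈-sym (≈-trans
    (∷-cong ⌞ i ⌟ ⌞ i ⌟ (≋-refl {⌞ i ⌟}) (∷-cong ⌞ bar i ⌟ (flip ⌞ i ⌟) (⌞bar⌟ i) ≈-refl))
    (cancel-∷ ⌞ i ⌟ (embed r)))

  embed-reduce : ∀ w → embed (reduce w) ≈ w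
  embed-reduce []      = ≈-refl
  embed-reduce (a ∷ w) = ≈-trans (embed-push ⌜ a ⌝ (reduce w))
    (∷-cong ⌞ ⌜ a ⌝ ⌟ a (⌞⌜⌝⌟ a) (embed-reduce w))

  reduce-embed : ∀ {r} → Reduced r → reduce (embed r) ≡ r
  reduce-embed {[]}    _ = refl
  reduce-embed {i ∷ r} p
    rewrite reduce-embed (Linked.tail p) | ⌜⌞⌟⌝ i = push-∷ i r (reduced-head p)

  ∣∣≡0⇒≈[] : ∀ w → ∣ w ∣ ≡ 0 → w ≈ []
  ∣∣≡0⇒≈[] w ∣w∣≡0 = ≈-trans (≈-sym (embed-reduce w)) (≡⇒≈ (cong embed (empty (reduce w) ∣w∣≡0)))
    where
    empty : ∀ (r : Code) → length r ≡ 0 → r ≡ []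
    empty [] _ = refl

  ∣∣≤length : ∀ w → ∣ w ∣ ≤ length w
  ∣∣≤length []      = z≤n
  ∣∣≤length (a ∷ w) = ≤-trans (length-push ⌜ a ⌝ (reduce w)) (s≤s (∣∣≤length w))

  -- All words for `g` have the same normal form, and reducing never lengthens a word.
  hasLength : ∀ g → HasLength g ∣ g ∣
  hasLength g =
    (embed (reduce g) , length-map ⌞_⌟ (reduce g) ,
      ≈-trans (≡⇒≈ (∏≡id (embed (reduce g)))) (embed-reduce g)) ,
    λ w w≈g → subst (_≤ length w)
      (∣∣-cong (≈-trans (≡⇒≈ (sym (∏≡id w))) w≈g)) (∣∣≤length w)

  hasLength-unique : ∀ {g m n} → HasLength g m → HasLength g n → m ≡ n
  hasLength-unique ((u , |u|≡m , u≈g) , m≤) ((v , |v|≡n , v≈g) , n≤) =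
    ≤-antisym (subst (_ ≤_) |v|≡n (m≤ v v≈g)) (subst (_ ≤_) |u|≡m (n≤ u u≈g))

  -- If `w` leads from a vertex to a target, then `flip a ∷ w` leads there from the neighbour along
  -- `a`. The distance drops when the geodesic starts with `a` and, by `head-grow`, rises otherwise.
  head-shrink : ∀ a w → head (reduce w) ≡ just ⌜ a ⌝ → ℕ.suc ∣ flip a ∷ w ∣ ≡ ∣ w ∣
  head-shrink a w h with j ∷ r ← reduce w | refl ← h =
    cong (ℕ.suc ∘ length) (push-cancel ⌜ flip a ⌝ ⌜ a ⌝ r
      (sym (trans (cong bar (⌜flip⌝ a)) (bar-involutive ⌜ a ⌝))))

  head-grow : ∀ a w → head (reduce w) ≢ just ⌜ a ⌝ →
              reduce (flip a ∷ w) ≡ ⌜ flip a ⌝ ∷ reduce w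
  head-grow a w h = push-∷ ⌜ flip a ⌝ (reduce w)
    (λ e → h (trans e (cong just (trans (cong bar (⌜flip⌝ a)) (bar-involutive ⌜ a ⌝)))))

  length-act : ∀ w r → length (act w r) ≤ length w + length r
  length-act []      r = ≤-refl
  length-act (a ∷ w) r = ≤-trans (length-push ⌜ a ⌝ (act w r)) (s≤s (length-act w r))

  private
    embed-∷-⁻¹ : ∀ i p q → act (embed (i ∷ p) ⁻¹) q ≡ act (embed p ⁻¹) (push (bar i) q)
    embed-∷-⁻¹ i p q = trans
      (cong (λ w → act w q) (unfold-reverse (flip ⌞ i ⌟) (map flip (embed p))))
      (act-++ (embed p ⁻¹) [ flip ⌞ i ⌟ ] q)

    length-embed⁻¹ : ∀ p → length (embed p ⁻¹) ≡ length p
    length-embed⁻¹ p = trans (length-reverse (map flip (embed p)))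
      (trans (length-map flip (embed p)) (length-map ⌞_⌟ p))

    -- The inverse word acts first with `bar i`, which cancels the head of `i ∷ q`; the rest of `p`
    -- adds at most its length.
    act⁻¹-common : ∀ i p q →
      length (act (embed (i ∷ p) ⁻¹) (i ∷ q)) ℕ.< length (i ∷ p) + length (i ∷ q)
    act⁻¹-common i p q
      rewrite embed-∷-⁻¹ i p (i ∷ q) | push-cancel (bar i) i q (sym (bar-involutive i)) =
      s≤s (≤-trans (length-act (embed p ⁻¹) q)
        (+-mono-≤ (≤-reflexive (length-embed⁻¹ p)) (n≤1+n _)))

    -- The letters of `p` move, inverted, onto `q` one by one. The hypothesis persists: the new head
    -- is `bar i`, which cannot follow `i` in a reduced word.
    act⁻¹-diverging : ∀ {p} q → Reduced p → Reduced q →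
      (∀ i → head p ≡ just i → head q ≢ just i) →
      length (act (embed p ⁻¹) q) ≡ length p + length q
    act⁻¹-diverging {[]}    q _ _ _ = refl
    act⁻¹-diverging {i ∷ p} q P Q h
      rewrite embed-∷-⁻¹ i p q
            | push-∷ (bar i) q (λ e → h i refl (trans e (cong just (bar-involutive i)))) =
      trans (act⁻¹-diverging (bar i ∷ q) (Linked.tail P)
              (reduced-∷ (λ e → h i refl (trans e (cong just (bar-involutive i)))) Q)
              λ { j hp refl → reduced-head P hp })
        (+-suc (length p) (length q))

    ∣⁻¹++∣ : ∀ u v → ∣ u ⁻¹ ++ v ∣ ≡ length (act (embed (reduce u) ⁻¹) (reduce v))
    ∣⁻¹++∣ u v = cong length (trans (act-++ (u ⁻¹) v [])
      (act-cong (Group.⁻¹-cong (𝒢 I J) (≈-sym (embed-reduce u))) (reduce-reduced v)))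

  -- With `diverging-heads⇒≡`, three lengths decide whether the geodesics of `u` and `v` share their
  -- first edge.
  common-head⇒< : ∀ u v i → head (reduce u) ≡ just i → head (reduce v) ≡ just i →
                  ∣ u ⁻¹ ++ v ∣ ℕ.< ∣ u ∣ + ∣ v ∣
  common-head⇒< u v i hu hv rewrite ∣⁻¹++∣ u v
    with reduce u | hu | reduce v | hv
  ... | _ ∷ p | refl | _ ∷ q | refl = act⁻¹-common i p q

  diverging-heads⇒≡ : ∀ u v → (∀ i → head (reduce u) ≡ just i → head (reduce v) ≢ just i) →
                      ∣ u ⁻¹ ++ v ∣ ≡ ∣ u ∣ + ∣ v ∣
  diverging-heads⇒≡ u v h =
    trans (∣⁻¹++∣ u v) (act⁻¹-diverging (reduce v) (reduce-reduced u) (reduce-reduced v) h)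

-- Extending partial injections of a finite set to permutations.

transpose-source : ∀ {n} (i j : Fin n) → transpose i j ⟨$⟩ʳ i ≡ j
transpose-source i j rewrite dec-true (i ≟ i) refl = refl

transpose-fixes : ∀ {n} {i j k : Fin n} → k ≢ i → k ≢ j → transpose i j ⟨$⟩ʳ k ≡ k
transpose-fixes {i = i} {j} {k} k≢i k≢j
  rewrite dec-false (k ≟ i) k≢i | dec-false (k ≟ j) k≢j = refl

module PartialInjections (em : ExcludedMiddle 0ℓ) {n : ℕ} where

  Functional Injective : (Fin n → Fin n → Set) → Set
  Functional R = ∀ {i j k} → R i j → R i k → j ≡ k
  Injective  R = ∀ {i j k} → R i k → R j k → i ≡ j

  -- Each transposition repairs one value and, R being injective, does not
  -- disturb the values repaired before.
  extend : (Fin n → Fin n → Set) → List (Fin n) → Permutation′ n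
  extend R []       = Permutation.id
  extend R (i ∷ is) with em {∃[ j ] R i j}
  ... | yes (j , _) = extend R is ∘ₚ transpose (extend R is ⟨$⟩ʳ i) j
  ... | no  _       = extend R is

  extend-extends : ∀ {R} → Functional R → Injective R →
                   ∀ {i j is} → i ∈ₗ is → R i j → extend R is ⟨$⟩ʳ i ≡ j
  extend-extends {R} fun inj {i} {j} {k ∷ is} i∈ Rij with em {∃[ l ] R k l} | i∈
  ... | no ¬Rk        | here refl  = contradiction (j , Rij) ¬Rk
  ... | no _          | there i∈is = extend-extends fun inj i∈is Rij
  ... | yes (l , Rkl) | here refl  = trans (transpose-source (extend R is ⟨$⟩ʳ k) l) (fun Rkl Rij)
  ... | yes (l , Rkl) | there i∈is with i ≟ k
  -- The list may contain `k` again; the outermost transposition still sets its value to `l`.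
  ...   | yes refl = trans (transpose-source (extend R is ⟨$⟩ʳ k) l) (fun Rkl Rij)
  ...   | no i≢k   = trans
    (transpose-fixes
      (λ e → i≢k (Injection.injective (↔⇒↣ (extend R is)) e))
      (λ e → i≢k (inj (subst (R i) (trans (sym IH) e) Rij) Rkl)))
    IH
    where IH = extend-extends fun inj i∈is Rij

  -- The witnesses chosen by `em` for `R` and `S` may come from different proofs, but functionality
  -- makes their values equal. Equivariance of the tree map rests on this independence.
  extend-cong : ∀ {R S} → Functional R → (∀ {i j} → R i j → S i j) → (∀ {i j} → S i j → R i j) →
                ∀ is i → extend R is ⟨$⟩ʳ i ≡ extend S is ⟨$⟩ʳ i
  extend-cong fun R⊆S S⊆R []       i = refl
  extend-cong {R} {S} fun R⊆S S⊆R (k ∷ is) i with em {∃[ j ] R k j} | em {∃[ j ] S k j}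
  ... | no _          | no _          = extend-cong fun R⊆S S⊆R is i
  ... | no ¬Rk        | yes (j , Skj) = contradiction (j , S⊆R Skj) ¬Rk
  ... | yes (j , Rkj) | no ¬Sk        = contradiction (j , R⊆S Rkj) ¬Sk
  ... | yes (j , Rkj) | yes (l , Skl)
    rewrite extend-cong {R} {S} fun R⊆S S⊆R is i | extend-cong {R} {S} fun R⊆S S⊆R is k
          | fun Rkj (S⊆R Skl) = refl

-- Reconstructing a translation from lengths.

module Reconstruction
  (em : ExcludedMiddle 0ℓ)
  {𝕂 𝕁 : Set} {I₁ I₂ : Pred 𝕂 0ℓ} {J₁ J₂ : Pred 𝕁 0ℓ}
  (H₁ : Subgroup (𝒢 I₁ J₁)) (H₂ : Subgroup (𝒢 I₂ J₂)) {d : ℕ}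
  (code₁ : Inverse (Words.letters I₁ J₁) (setoid (Fin d)))
  (code₂ : Inverse (Words.letters I₂ J₂) (setoid (Fin d)))
  (lengthIsomorphic : LengthIsomorphic (𝒳 I₁ J₁) (𝒳 I₂ J₂) H₁ H₂)
  where

  private
    module W₁ = Words I₁ J₁
    module W₂ = Words I₂ J₂
    module G₁ = Group (𝒢 I₁ J₁)
    module G₂ = Group (𝒢 I₂ J₂)
    module G₁P = GroupProperties (𝒢 I₁ J₁)
    module G₂P = GroupProperties (𝒢 I₂ J₂)
    module S₁ = Subgroup H₁
    module S₂ = Subgroup H₂
    module H₁ = Group S₁.group
    module H₂ = Group S₂.group
    module N₁ = NormalForm I₁ J₁ code₁
    module N₂ = NormalForm I₂ J₂ code₂
  open PartialInjections em {d}
  open GroupMorphisms H₁.rawGroup H₂.rawGroup using (module IsGroupIsomorphism)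

  α : H₁.Carrier → H₂.Carrier
  α = proj₁ lengthIsomorphic

  private module α = IsGroupIsomorphism (proj₁ (proj₂ lengthIsomorphic))

  α-preserves-∣∣ : ∀ h → N₁.∣ proj₁ h ∣ ≡ N₂.∣ proj₁ (α h) ∣
  α-preserves-∣∣ h = N₂.hasLength-unique
    (Equivalence.to (proj₂ (proj₂ lengthIsomorphic) h N₁.∣ proj₁ h ∣) (N₁.hasLength (proj₁ h)))
    (N₂.hasLength (proj₁ (α h)))

  α-isometry : ∀ u u′ h k →
    N₁.∣ (u ++ proj₁ h) W₁.⁻¹ ++ (u ++ proj₁ k) ∣ ≡
    N₂.∣ (u′ ++ proj₁ (α h)) W₂.⁻¹ ++ (u′ ++ proj₁ (α k)) ∣
  α-isometry u u′ h k = begin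
    N₁.∣ (u ++ proj₁ h) W₁.⁻¹ ++ (u ++ proj₁ k) ∣
      ≡⟨ N₁.∣∣-cong (quotient-cancel (𝒢 I₁ J₁) u (proj₁ h) (proj₁ k)) ⟩
    N₁.∣ proj₁ h W₁.⁻¹ ++ proj₁ k ∣
      ≡⟨ α-preserves-∣∣ (h H₁.⁻¹ H₁.∙ k) ⟩
    N₂.∣ proj₁ (α (h H₁.⁻¹ H₁.∙ k)) ∣
      ≡⟨ N₂.∣∣-cong (W₂.≈-trans (α.∙-homo (h H₁.⁻¹) k)
           (W₂.++-cong (α.⁻¹-homo h) (W₂.≈-refl {proj₁ (α k)}))) ⟩
    N₂.∣ proj₁ (α h) W₂.⁻¹ ++ proj₁ (α k) ∣
      ≡⟨ N₂.∣∣-cong (quotient-cancel (𝒢 I₂ J₂) u′ (proj₁ (α h)) (proj₁ (α k))) ⟨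
    N₂.∣ (u′ ++ proj₁ (α h)) W₂.⁻¹ ++ (u′ ++ proj₁ (α k)) ∣ ∎
    where open ≡-Reasoning

  -- The vertex g is represented by u = g⁻¹, so that d(g , h) = ∣ u h ∣ and the
  -- first edge from g towards h is the head of the reduced form of u h.
  Matched : W₁.Word → W₂.Word → Set
  Matched u u′ = ∀ h → N₁.∣ u ++ proj₁ h ∣ ≡ N₂.∣ u′ ++ proj₁ (α h) ∣

  Directions : W₁.Word → W₂.Word → Fin d → Fin d → Set
  Directions u u′ i j = ∃[ h ]
    head (N₁.reduce (u ++ proj₁ h)) ≡ just i × head (N₂.reduce (u′ ++ proj₁ (α h))) ≡ just j

  module _ {u u′} (m : Matched u u′) where

    -- A shared first edge makes the distance from `h` to `k` smaller than the sum of the distances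
    -- to them; distinct first edges on the other side make it equal to that sum. By `α-isometry`
    -- and `m` both cannot occur.
    directions-functional : Functional (Directions u u′)
    directions-functional {j = j} {j′} (h , p , q) (k , p′ , q′) with j ≟ j′
    ... | yes j≡j′ = j≡j′
    ... | no  j≢j′ = contradiction
      (N₁.common-head⇒< (u ++ proj₁ h) (u ++ proj₁ k) _ p p′)
      (<-irrefl (trans (α-isometry u u′ h k) (trans
        (N₂.diverging-heads⇒≡ (u′ ++ proj₁ (α h)) (u′ ++ proj₁ (α k))
          λ i r r′ → j≢j′ (just-injective (trans (sym q) (trans r (trans (sym r′) q′)))))
        (sym (cong₂ _+_ (m h) (m k))))))

    directions-injective : Injective (Directions u u′)
    directions-injective {i = i} {i′} (h , p , q) (k , p′ , q′) with i ≟ i′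
    ... | yes i≡i′ = i≡i′
    ... | no  i≢i′ = contradiction
      (N₂.common-head⇒< (u′ ++ proj₁ (α h)) (u′ ++ proj₁ (α k)) _ q q′)
      (<-irrefl (trans (sym (α-isometry u u′ h k)) (trans
        (N₁.diverging-heads⇒≡ (u ++ proj₁ h) (u ++ proj₁ k)
          λ i r r′ → i≢i′ (just-injective (trans (sym p) (trans r (trans (sym r′) p′)))))
        (cong₂ _+_ (m h) (m k)))))

  σ : W₁.Word → W₂.Word → Permutation′ d
  σ u u′ = extend (Directions u u′) (allFin d)

  σ-extends : ∀ u u′ → Matched u u′ → ∀ {i j} → Directions u u′ i j → σ u u′ ⟨$⟩ʳ i ≡ j
  σ-extends u u′ m =
    extend-extends (directions-functional {u} {u′} m) (directions-injective {u} {u′} m) (∈-allFin _)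

  same-length-head : ∀ {A B : Set} {r : List A} {r′ : List B} {i} →
                     length r ≡ length r′ → head r ≡ just i → ∃[ j ] head r′ ≡ just j
  same-length-head {r = _ ∷ _} {_ ∷ _} _ _ = _ , refl

  -- As vertices are represented by inverses, moving along the image edge prepends its flipped
  -- letter.
  step : W₁.Word → W₂.Word → W₁.Letter → W₂.Letter
  step u u′ a = flip N₂.⌞ σ u u′ ⟨$⟩ʳ N₁.⌜ a ⌝ ⌟

  -- The distance to `h` drops by one along an edge towards `h` and grows by one along any other.
  -- Since `σ` is a bijection extending `Directions`, the image edge leads towards `α h` in exactly
  -- the same cases.
  matched-step : ∀ u u′ → Matched u u′ → ∀ a → Matched (flip a ∷ u) (step u u′ a ∷ u′)
  matched-step u u′ m a h with ≡-dec _≟_ (head (N₁.reduce (u ++ proj₁ h))) (just N₁.⌜ a ⌝)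
  ... | yes p with (j , q) ← same-length-head (m h) p = suc-injective (begin
      ℕ.suc N₁.∣ flip a ∷ (u ++ proj₁ h) ∣       ≡⟨ N₁.head-shrink a (u ++ proj₁ h) p ⟩
      N₁.∣ u ++ proj₁ h ∣                        ≡⟨ m h ⟩
      N₂.∣ u′ ++ proj₁ (α h) ∣                   ≡⟨ N₂.head-shrink b (u′ ++ proj₁ (α h)) q′ ⟨
      ℕ.suc N₂.∣ flip b ∷ (u′ ++ proj₁ (α h)) ∣  ∎)
    where
    open ≡-Reasoning
    b = N₂.⌞ σ u u′ ⟨$⟩ʳ N₁.⌜ a ⌝ ⌟

    q′ : head (N₂.reduce (u′ ++ proj₁ (α h))) ≡ just N₂.⌜ b ⌝
    q′ = trans q (cong just (sym (trans (N₂.⌜⌞⌟⌝ _) (σ-extends u u′ m (h , p , q)))))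
  ... | no ¬p = begin
      N₁.∣ flip a ∷ (u ++ proj₁ h) ∣             ≡⟨ cong length (N₁.head-grow a (u ++ proj₁ h) ¬p) ⟩
      ℕ.suc N₁.∣ u ++ proj₁ h ∣                  ≡⟨ cong ℕ.suc (m h) ⟩
      ℕ.suc N₂.∣ u′ ++ proj₁ (α h) ∣             ≡⟨ cong length (N₂.head-grow b (u′ ++ proj₁ (α h)) ¬q) ⟨
      N₂.∣ flip b ∷ (u′ ++ proj₁ (α h)) ∣        ∎
    where
    open ≡-Reasoning
    b = N₂.⌞ σ u u′ ⟨$⟩ʳ N₁.⌜ a ⌝ ⌟

    ¬q : head (N₂.reduce (u′ ++ proj₁ (α h))) ≢ just N₂.⌜ b ⌝
    ¬q q with (i , p) ← same-length-head (sym (m h)) q = ¬p (trans p (cong just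
      (Injection.injective (↔⇒↣ (σ u u′))
        (trans (σ-extends u u′ m (h , p , q)) (N₂.⌜⌞⌟⌝ _)))))

  -- The map of trees.  It is defined outwards from the identity: further out
  -- the edge leading back is in the partial injection (take h = ε), but the
  -- edge leading away need not be in the partial injection of its far end.
  φ : N₁.Code → W₂.Word
  φ []      = []
  φ (i ∷ r) = step (N₁.embed r) (φ r) (flip N₁.⌞ i ⌟) ∷ φ r

  matched : ∀ r → Matched (N₁.embed r) (φ r)
  matched []      = α-preserves-∣∣
  matched (i ∷ r) = subst (λ a → Matched (a ∷ N₁.embed r) (φ (i ∷ r)))
    (flip-involutive N₁.⌞ i ⌟) (matched-step (N₁.embed r) (φ r) (matched r) (flip N₁.⌞ i ⌟))

  s : N₁.Code → Permutation′ d
  s r = σ (N₁.embed r) (φ r)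

  ∣φ∣ : ∀ {r} → N₁.Reduced r → N₂.∣ φ r ∣ ≡ length r
  ∣φ∣ {r} R = begin
    N₂.∣ φ r ∣                        ≡⟨ cong N₂.∣_∣ (++-identityʳ (φ r)) ⟨
    N₂.∣ φ r ++ [] ∣                  ≡⟨ N₂.∣∣-cong (W₂.++-cong (W₂.≈-refl {φ r}) α.ε-homo) ⟨
    N₂.∣ φ r ++ proj₁ (α H₁.ε) ∣      ≡⟨ matched r H₁.ε ⟨
    N₁.∣ N₁.embed r ++ [] ∣           ≡⟨ cong N₁.∣_∣ (++-identityʳ (N₁.embed r)) ⟩
    N₁.∣ N₁.embed r ∣                 ≡⟨ cong length (N₁.reduce-embed R) ⟩
    length r                          ∎
    where open ≡-Reasoning

  -- At `i ∷ r` the letter `i` leads back towards the identity. On the image side `φ` has just grown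
  -- by one letter, so the way back is the inverse of that step; these two letters are related by
  -- `Directions`.
  s-∷ : ∀ i r → N₁.Reduced (i ∷ r) → s (i ∷ r) ⟨$⟩ʳ i ≡ N₂.bar (s r ⟨$⟩ʳ N₁.bar i)
  s-∷ i r R = σ-extends (N₁.embed (i ∷ r)) (φ (i ∷ r)) (matched (i ∷ r)) (H₁.ε , head₁ , head₂)
    where
    open ≡-Reasoning
    b = N₂.⌞ s r ⟨$⟩ʳ N₁.bar i ⌟

    ¬shrink : head (N₂.reduce (φ r)) ≢ just N₂.⌜ b ⌝
    ¬shrink p = <-irrefl
      (trans (sym (trans (N₂.head-shrink b (φ r) p) (∣φ∣ (Linked.tail R)))) (cong ℕ.suc (∣φ∣ R)))
      (s≤s (n≤1+n (length r)))

    head₁ : head (N₁.reduce (N₁.embed (i ∷ r) ++ [])) ≡ just i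
    head₁ = cong head (trans (cong N₁.reduce (++-identityʳ (N₁.embed (i ∷ r)))) (N₁.reduce-embed R))

    head₂ : head (N₂.reduce (φ (i ∷ r) ++ proj₁ (α H₁.ε))) ≡ just (N₂.bar (s r ⟨$⟩ʳ N₁.bar i))
    head₂ = cong head (begin
      N₂.reduce (φ (i ∷ r) ++ proj₁ (α H₁.ε))
        ≡⟨ N₂.reduce-cong (W₂.++-cong (W₂.≈-refl {φ (i ∷ r)}) α.ε-homo) ⟩
      N₂.reduce (φ (i ∷ r) ++ [])
        ≡⟨ cong N₂.reduce (++-identityʳ (φ (i ∷ r))) ⟩
      N₂.reduce (flip b ∷ φ r)
        ≡⟨ N₂.head-grow b (φ r) ¬shrink ⟩
      N₂.⌜ flip b ⌝ ∷ N₂.reduce (φ r) ∎)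

  -- The edge leads either outwards, where `s-∷` applies at its far end, or back towards the
  -- identity, where `s-∷` at its near end is read in reverse.
  s-flip : ∀ i {r} → N₁.Reduced r →
           s (N₁.push (N₁.bar i) r) ⟨$⟩ʳ N₁.bar i ≡ N₂.bar (s r ⟨$⟩ʳ i)
  s-flip i {[]}    R = trans (s-∷ (N₁.bar i) [] [-])
    (cong (λ k → N₂.bar (s [] ⟨$⟩ʳ k)) (N₁.bar-involutive i))
  s-flip i {j ∷ r} R with j ≟ N₁.bar (N₁.bar i)
  ... | no  p = trans (s-∷ (N₁.bar i) (j ∷ r) (p ∷ R))
    (cong (λ k → N₂.bar (s (j ∷ r) ⟨$⟩ʳ k)) (N₁.bar-involutive i))
  ... | yes p with refl ← trans p (N₁.bar-involutive i) =
    sym (trans (cong N₂.bar (s-∷ i r R)) (N₂.bar-involutive _))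

  -- Extends the recursion of `φ` to steps in all directions: outwards it is the definition, and
  -- inwards `s-∷` shows that the letter undoes the step out.
  φ-push : ∀ i {r} → N₁.Reduced r →
           φ (N₁.push (N₁.bar i) r) W₂.≈ flip N₂.⌞ s r ⟨$⟩ʳ i ⌟ ∷ φ r
  φ-push i {[]}    R = W₂.≡⇒≈
    (cong (λ k → flip N₂.⌞ s [] ⟨$⟩ʳ k ⌟ ∷ []) (N₁.bar-involutive i))
  φ-push i {j ∷ r} R with j ≟ N₁.bar (N₁.bar i)
  ... | no  p = W₂.≡⇒≈
    (cong (λ k → flip N₂.⌞ s (j ∷ r) ⟨$⟩ʳ k ⌟ ∷ φ (j ∷ r)) (N₁.bar-involutive i))
  ... | yes p with refl ← trans p (N₁.bar-involutive i) = W₂.≈-sym (begin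
      flip N₂.⌞ s (i ∷ r) ⟨$⟩ʳ i ⌟ ∷ φ (i ∷ r)
        ≡⟨ cong (λ k → flip N₂.⌞ k ⌟ ∷ φ (i ∷ r)) (s-∷ i r R) ⟩
      flip N₂.⌞ N₂.bar k ⌟ ∷ φ (i ∷ r)
        ≈⟨ W₂.∷-cong (flip N₂.⌞ N₂.bar k ⌟) (flip (flip N₂.⌞ k ⌟))
             (W₂.flip-cong N₂.⌞ N₂.bar k ⌟ (flip N₂.⌞ k ⌟) (N₂.⌞bar⌟ k)) (W₂.≈-refl {φ (i ∷ r)}) ⟩
      flip (flip N₂.⌞ k ⌟) ∷ φ (i ∷ r)
        ≡⟨ cong (_∷ φ (i ∷ r)) (flip-involutive N₂.⌞ k ⌟) ⟩
      N₂.⌞ k ⌟ ∷ flip N₂.⌞ k ⌟ ∷ φ r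
        ≈⟨ W₂.cancel-∷ N₂.⌞ k ⌟ (φ r) ⟩
      φ r ∎)
    where
    open SetoidReasoning W₂.≈-setoid
    k = s r ⟨$⟩ʳ N₁.bar i

  -- Equivariance of the map of trees.

  Φ : W₁.Word → W₂.Word
  Φ u = φ (N₁.reduce u)

  Φ-cong : ∀ {u v} → u W₁.≈ v → Φ u ≡ Φ v
  Φ-cong u≈v = cong φ (N₁.reduce-cong u≈v)

  Φ-∷ : ∀ a u → Φ (flip a ∷ u) W₂.≈ flip N₂.⌞ s (N₁.reduce u) ⟨$⟩ʳ N₁.⌜ a ⌝ ⌟ ∷ Φ u
  Φ-∷ a u rewrite N₁.⌜flip⌝ a = φ-push N₁.⌜ a ⌝ (N₁.reduce-reduced u)

  -- The target `k` seen from `u h` is the target `h k` seen from `u`.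
  directions-shift : ∀ {u v u′ v′} h → u ++ proj₁ h W₁.≈ v → u′ ++ proj₁ (α h) W₂.≈ v′ →
                     ∀ {i j} → Directions v v′ i j → Directions u u′ i j
  directions-shift {u} {v} {u′} {v′} h uh≈v u′h≈v′ (k , p , q) = h H₁.∙ k ,
    trans (cong head (N₁.reduce-cong (W₁.≈-trans
      (W₁.≡⇒≈ (sym (++-assoc u (proj₁ h) (proj₁ k))))
      (G₁.∙-congʳ {proj₁ k} uh≈v)))) p ,
    trans (cong head (N₂.reduce-cong (W₂.≈-trans
      (G₂.∙-congˡ {u′} (α.∙-homo h k)) (W₂.≈-trans
      (W₂.≡⇒≈ (sym (++-assoc u′ (proj₁ (α h)) (proj₁ (α k)))))
      (G₂.∙-congʳ {proj₁ (α k)} u′h≈v′))))) q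

  s-equivariant : ∀ u h → Φ (u ++ proj₁ h) W₂.≈ Φ u ++ proj₁ (α h) →
                  ∀ i → s (N₁.reduce u) ⟨$⟩ʳ i ≡ s (N₁.reduce (u ++ proj₁ h)) ⟨$⟩ʳ i
  s-equivariant u h Φuh≈ = extend-cong
    (directions-functional {v} {Φ u} (matched (N₁.reduce u)))
    (directions-shift (h H₁.⁻¹) vh⁻¹≈ Φvh⁻¹≈)
    (directions-shift h vh≈ (W₂.≈-sym Φuh≈))
    (allFin d)
    where
    v = N₁.embed (N₁.reduce u)
    vh = N₁.embed (N₁.reduce (u ++ proj₁ h))

    vh≈ : v ++ proj₁ h W₁.≈ vh
    vh≈ = W₁.≈-trans (G₁.∙-congʳ {proj₁ h} (N₁.embed-reduce u))
      (W₁.≈-sym (N₁.embed-reduce (u ++ proj₁ h)))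

    vh⁻¹≈ : vh ++ proj₁ h W₁.⁻¹ W₁.≈ v
    vh⁻¹≈ = W₁.≈-trans (G₁.∙-congʳ {proj₁ h W₁.⁻¹} (W₁.≈-sym vh≈))
      (G₁P.//-rightDividesʳ (proj₁ h) v)

    Φvh⁻¹≈ : Φ (u ++ proj₁ h) ++ proj₁ (α (h H₁.⁻¹)) W₂.≈ Φ u
    Φvh⁻¹≈ = W₂.≈-trans (W₂.++-cong Φuh≈ (α.⁻¹-homo h))
      (G₂P.//-rightDividesʳ (proj₁ (α h)) (Φ u))

  -- Matching at the target `h ⁻¹` compares the lengths of `u h⁻¹` and `Φ u (α h)⁻¹`, and only the
  -- identity has length 0.
  Φ≈⇒≈ : ∀ u h → Φ u W₂.≈ proj₁ (α h) → u W₁.≈ proj₁ h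
  Φ≈⇒≈ u h Φu≈αh = W₁.≈-trans (W₁.≈-sym (N₁.embed-reduce u))
    (G₁P.x∙y⁻¹≈ε⇒x≈y v (proj₁ h) (N₁.∣∣≡0⇒≈[] (v ++ proj₁ h W₁.⁻¹) (begin
      N₁.∣ v ++ proj₁ h W₁.⁻¹ ∣                  ≡⟨ matched (N₁.reduce u) (h H₁.⁻¹) ⟩
      N₂.∣ Φ u ++ proj₁ (α (h H₁.⁻¹)) ∣          ≡⟨ N₂.∣∣-cong (W₂.++-cong Φu≈αh (α.⁻¹-homo h)) ⟩
      N₂.∣ proj₁ (α h) ++ proj₁ (α h) W₂.⁻¹ ∣    ≡⟨ N₂.∣∣-cong (G₂.inverseʳ (proj₁ (α h))) ⟩
      0                                          ∎)))
    where
    open ≡-Reasoning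
    v = N₁.embed (N₁.reduce u)

  Φ≈α : ∀ h → Φ (proj₁ h) W₂.≈ proj₁ (α h)
  Φ≈α h = G₂P.x∙y⁻¹≈ε⇒x≈y (Φ (proj₁ h)) (proj₁ (α h)) (W₂.≈-trans
    (G₂.∙-congˡ {Φ (proj₁ h)} (W₂.≈-sym (α.⁻¹-homo h)))
    (N₂.∣∣≡0⇒≈[] (Φ (proj₁ h) ++ proj₁ (α (h H₁.⁻¹))) (begin
      N₂.∣ Φ (proj₁ h) ++ proj₁ (α (h H₁.⁻¹)) ∣  ≡⟨ matched (N₁.reduce (proj₁ h)) (h H₁.⁻¹) ⟨
      N₁.∣ v ++ proj₁ h W₁.⁻¹ ∣                  ≡⟨ N₁.∣∣-cong vh⁻¹≈[] ⟩
      0                                          ∎)))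
    where
    open ≡-Reasoning
    v = N₁.embed (N₁.reduce (proj₁ h))

    vh⁻¹≈[] : v ++ proj₁ h W₁.⁻¹ W₁.≈ []
    vh⁻¹≈[] = W₁.≈-trans
      (G₁.∙-congʳ {proj₁ h W₁.⁻¹} (N₁.embed-reduce (proj₁ h))) (G₁.inverseʳ (proj₁ h))

  -- Induction on `u`: the hypothesis feeds `s-equivariant`, so both sides acquire the same new
  -- letter.
  Φ-equivariant : ∀ u h → Φ (u ++ proj₁ h) W₂.≈ Φ u ++ proj₁ (α h)
  Φ-equivariant []      h = Φ≈α h
  Φ-equivariant (a ∷ u) h = subst
    (λ b → Φ (b ∷ u ++ proj₁ h) W₂.≈ Φ (b ∷ u) ++ proj₁ (α h)) (flip-involutive a) (begin
    Φ (flip (flip a) ∷ u ++ proj₁ h)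
      ≈⟨ Φ-∷ (flip a) (u ++ proj₁ h) ⟩
    flip N₂.⌞ s (N₁.reduce (u ++ proj₁ h)) ⟨$⟩ʳ i ⌟ ∷ Φ (u ++ proj₁ h)
      ≡⟨ cong (λ k → flip N₂.⌞ k ⌟ ∷ Φ (u ++ proj₁ h)) (s-equivariant u h IH i) ⟨
    flip N₂.⌞ s (N₁.reduce u) ⟨$⟩ʳ i ⌟ ∷ Φ (u ++ proj₁ h)
      ≈⟨ W₂.++-cong (W₂.≈-refl {[ flip N₂.⌞ s (N₁.reduce u) ⟨$⟩ʳ i ⌟ ]}) IH ⟩
    (flip N₂.⌞ s (N₁.reduce u) ⟨$⟩ʳ i ⌟ ∷ Φ u) ++ proj₁ (α h)
      ≈⟨ G₂.∙-congʳ {proj₁ (α h)} (Φ-∷ (flip a) u) ⟨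
    Φ (flip (flip a) ∷ u) ++ proj₁ (α h) ∎)
    where
    open SetoidReasoning W₂.≈-setoid
    IH = Φ-equivariant u h
    i = N₁.⌜ flip a ⌝

  local : LocalTranslation H₁ H₂
  local = record
    { τ       = λ g → Composition.inverse code₁
        (Composition.inverse (s (N₁.reduce (g W₁.⁻¹))) (Symmetry.inverse code₂))
    -- The inverse of `k` is `g⁻¹` times the element `g k⁻¹` of `H₁`, so the two inverses differ by
    -- right multiplication by an element of `H₁`.
    ; τ-coset = λ g k gk⁻¹∈H₁ a → W₂.≡⇒≋ (cong N₂.⌞_⌟ (trans
        (s-equivariant (g W₁.⁻¹) (g ++ k W₁.⁻¹ , gk⁻¹∈H₁)
          (Φ-equivariant (g W₁.⁻¹) (g ++ k W₁.⁻¹ , gk⁻¹∈H₁)) N₁.⌜ a ⌝)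
        (cong (λ r → s r ⟨$⟩ʳ N₁.⌜ a ⌝)
          (N₁.reduce-cong (G₁P.\\-leftDividesʳ g (k W₁.⁻¹))))))
    ; τ-flip  = λ g a → let r = N₁.reduce (g W₁.⁻¹) in
        W₂.≋-trans {N₂.⌞ s (N₁.reduce ((g ++ [ a ]) W₁.⁻¹)) ⟨$⟩ʳ N₁.⌜ flip a ⌝ ⌟}
                   {N₂.⌞ N₂.bar (s r ⟨$⟩ʳ N₁.⌜ a ⌝) ⌟}
                   {flip N₂.⌞ s r ⟨$⟩ʳ N₁.⌜ a ⌝ ⌟}
          (W₂.≡⇒≋ (cong N₂.⌞_⌟ (begin
            s (N₁.reduce ((g ++ [ a ]) W₁.⁻¹)) ⟨$⟩ʳ N₁.⌜ flip a ⌝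
              ≡⟨ cong (λ r → s r ⟨$⟩ʳ N₁.⌜ flip a ⌝)
                   (N₁.reduce-cong (G₁P.⁻¹-anti-homo-∙ g [ a ])) ⟩
            s (N₁.push N₁.⌜ flip a ⌝ r) ⟨$⟩ʳ N₁.⌜ flip a ⌝
              ≡⟨ cong (λ i → s (N₁.push i r) ⟨$⟩ʳ i) (N₁.⌜flip⌝ a) ⟩
            s (N₁.push (N₁.bar N₁.⌜ a ⌝) r) ⟨$⟩ʳ N₁.bar N₁.⌜ a ⌝
              ≡⟨ s-flip N₁.⌜ a ⌝ (N₁.reduce-reduced (g W₁.⁻¹)) ⟩
            N₂.bar (s r ⟨$⟩ʳ N₁.⌜ a ⌝) ∎)))
          (N₂.⌞bar⌟ (s r ⟨$⟩ʳ N₁.⌜ a ⌝))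
    }
    where open ≡-Reasoning

  open LocalTranslation local using (τ⁺; T)

  -- On vertices the map of trees is `g ↦ Φ (g⁻¹)⁻¹`, and `T g w` spells the image of the path from
  -- `g` to `g w`.
  Φ⁻¹-T : ∀ g w → Φ (g W₁.⁻¹) W₂.⁻¹ ++ T g w W₂.≈ Φ ((g ++ w) W₁.⁻¹) W₂.⁻¹
  Φ⁻¹-T g []      = W₂.≡⇒≈ (trans (++-identityʳ (Φ (g W₁.⁻¹) W₂.⁻¹))
    (cong (λ k → Φ (k W₁.⁻¹) W₂.⁻¹) (sym (++-identityʳ g))))
  Φ⁻¹-T g (a ∷ w) = begin
    z W₂.⁻¹ ++ (b ∷ T (g ++ [ a ]) w)
      ≡⟨ ++-assoc (z W₂.⁻¹) [ b ] (T (g ++ [ a ]) w) ⟨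
    (z W₂.⁻¹ ++ [ b ]) ++ T (g ++ [ a ]) w
      ≈⟨ G₂.∙-congʳ {T (g ++ [ a ]) w} step⁻¹ ⟩
    Φ ((g ++ [ a ]) W₁.⁻¹) W₂.⁻¹ ++ T (g ++ [ a ]) w
      ≈⟨ Φ⁻¹-T (g ++ [ a ]) w ⟩
    Φ (((g ++ [ a ]) ++ w) W₁.⁻¹) W₂.⁻¹
      ≡⟨ cong (λ k → Φ (k W₁.⁻¹) W₂.⁻¹) (++-assoc g [ a ] w) ⟩
    Φ ((g ++ a ∷ w) W₁.⁻¹) W₂.⁻¹ ∎
    where
    open SetoidReasoning W₂.≈-setoid
    b = τ⁺ g a
    z = Φ (g W₁.⁻¹)

    step⁻¹ : z W₂.⁻¹ ++ [ b ] W₂.≈ Φ ((g ++ [ a ]) W₁.⁻¹) W₂.⁻¹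
    step⁻¹ = begin
      z W₂.⁻¹ ++ [ b ]                  ≡⟨ cong (λ c → z W₂.⁻¹ ++ [ c ]) (flip-involutive b) ⟨
      z W₂.⁻¹ ++ [ flip b ] W₂.⁻¹       ≈⟨ G₂P.⁻¹-anti-homo-∙ [ flip b ] z ⟨
      (flip b ∷ z) W₂.⁻¹                ≈⟨ G₂.⁻¹-cong (Φ-∷ a (g W₁.⁻¹)) ⟨
      Φ (flip a ∷ g W₁.⁻¹) W₂.⁻¹        ≡⟨ cong W₂._⁻¹ (Φ-cong (G₁P.⁻¹-anti-homo-∙ g [ a ])) ⟨
      Φ ((g ++ [ a ]) W₁.⁻¹) W₂.⁻¹      ∎

  -- At the root `T [] w` is the inverse of `Φ (w⁻¹)`, which for `w` in `H₁` is a value of `α`.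
  -- Conversely, surjectivity gives `h` with `α h ≈ Φ (w⁻¹)`, and `Φ≈⇒≈` identifies `w⁻¹` with `h`.
  translation : Translation H₁ H₂
  translation = record
    { local = local
    ; T-∈   = λ w → mk⇔
        (λ w∈H₁ → S₂.resp (W₂.≈-sym (Φ⁻¹-T [] w)) (S₂.⁻¹-closed
          (S₂.resp (W₂.≈-sym (Φ≈α (w W₁.⁻¹ , S₁.⁻¹-closed w∈H₁)))
            (proj₂ (α (w W₁.⁻¹ , S₁.⁻¹-closed w∈H₁))))))
        (λ Tw∈H₂ →
          let Φ∈H₂ = S₂.resp (G₂P.⁻¹-involutive (Φ (w W₁.⁻¹)))
                       (S₂.⁻¹-closed (S₂.resp (Φ⁻¹-T [] w) Tw∈H₂))
              (h , αh≈) = α.surjective (Φ (w W₁.⁻¹) , Φ∈H₂)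
          in S₁.resp (G₁P.⁻¹-involutive w) (S₁.⁻¹-closed
               (S₁.resp (W₁.≈-sym (Φ≈⇒≈ (w W₁.⁻¹) h (W₂.≈-sym (αh≈ {h} W₁.≈-refl))))
                 (proj₂ h))))
    }

theorem4p5 : ExcludedMiddle 0ℓ →
    {𝕂 𝕁 : Set}
    (I₁ I₂ : Pred 𝕂 0ℓ) (J₁ J₂ : Pred 𝕁 0ℓ)
    (H₁ : Subgroup (𝒢 I₁ J₁)) (H₂ : Subgroup (𝒢 I₂ J₂)) →
    (RootedIsomorphic H₁ H₂ →
    SameDegree (𝒳 I₁ J₁) (𝒳 I₂ J₂) ×
    LengthIsomorphic (𝒳 I₁ J₁) (𝒳 I₂ J₂) H₁ H₂) ×
    (FiniteDegree (𝒳 I₁ J₁) →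
    SameDegree (𝒳 I₁ J₁) (𝒳 I₂ J₂) ×
    LengthIsomorphic (𝒳 I₁ J₁) (𝒳 I₂ J₂) H₁ H₂ →
    RootedIsomorphic H₁ H₂) ×
    (RootedLabelIsomorphic H₁ H₂ ⇔ EqualSubgroups H₁ H₂)
theorem4p5 em I₁ I₂ J₁ J₂ H₁ H₂ =
  (λ (f , root-f) → let t = isomorphism⇒translation H₁ H₂ f root-f in
    Translation.sameDegree t , Translation.lengthIsomorphic t) ,
  (λ (d , finite) (degree , lengths) →
    -- Equality of degrees lets the same `Fin d` number the letters of both groups.
    let code₁ = Composition.inverse (Symmetry.inverse (star≅letters (𝒳 I₁ J₁))) finite
        code₂ = Composition.inverse (Symmetry.inverse (star≅letters (𝒳 I₂ J₂)))
                  (Composition.inverse (Symmetry.inverse degree) finite)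
        t = Reconstruction.translation em H₁ H₂ code₁ code₂ lengths
    -- The root goes to `T [] []`, which computes to `[]`.
    in Translation.isomorphism t , RightCosets.∼-refl H₂ {[]}) ,
  labelIsomorphic⇔equal H₁ H₂ em
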